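{- There is a polynomial-time algorithm that, given a co-tree $G$, computes the b-chromatic number $\chi_b(G)$.
   Context: Graphs are finite and simple. A co-tree is a graph whose complement is a tree. A b-coloring of a graph with $t$ colors is a proper coloring of the vertices with $t$ colors such that every color class contains a vertex that is adjacent to all other $t-1$ color classes. The b-chromatic number $\chi_b(G)$ is the maximum $t$ such that $G$ admits a b-coloring with $t$ colors. -}

module Defs where

open import Data.Bool using (Bool; true; false; not; _∧_; T)
open import Data.Fin using (Fin; zero)
open import Data.Fin.Properties using (_≟_)
open import Data.List using (List; []; _∷_; _∷ʳ_; foldr; length; tabulate)
open import Data.List.Relation.Unary.Linked using (Linked)
open import Data.List.Relation.Unary.Unique.Propositional using (Unique)
open import Data.Nat using (ℕ; zero; suc; _+_; _≤_; NonZero)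
open import Data.Product using (∃-syntax; _×_)
open import Data.Vec using (Vec; lookup; _[_]≔_; _∷_; replicate)
open import Relation.Binary.Construct.Closure.ReflexiveTransitive using (Star)
open import Relation.Binary.PropositionalEquality using (_≡_; _≢_; refl; sym; cong; cong₂)
open import Relation.Nullary using (¬_; yes; no; contradiction)
open import Relation.Nullary.Decidable using (⌊_⌋)

record Graph (n : ℕ) : Set where
  field
    adj       : Fin n → Fin n → Bool
    symmetric : ∀ u v → adj u v ≡ adj v u
    loopless  : ∀ v → adj v v ≡ false

  Adj : Fin n → Fin n → Set
  Adj u v = T (adj u v)

open Graph public

private
  ≟-sym : ∀ {n} (u v : Fin n) → ⌊ u ≟ v ⌋ ≡ ⌊ v ≟ u ⌋
  ≟-sym u v with u ≟ v | v ≟ u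
  ... | yes _   | yes _   = refl
  ... | no _    | no _    = refl
  ... | yes u≡v | no v≢u  = contradiction (sym u≡v) v≢u
  ... | no u≢v  | yes v≡u = contradiction (sym v≡u) u≢v

complement : ∀ {n} → Graph n → Graph n
complement G .adj u v = not ⌊ u ≟ v ⌋ ∧ not (adj G u v)
complement G .symmetric u v =
  cong₂ (λ a b → not a ∧ not b) (≟-sym u v) (symmetric G u v)
complement G .loopless v with v ≟ v
... | yes _  = refl
... | no v≢v = contradiction refl v≢v

Connected : ∀ {n} → Graph n → Set
Connected {n} G = NonZero n × (∀ u v → Star (Adj G) u v)

-- A cycle is a closed walk u, vs, u through at least three vertices which are
-- pairwise distinct apart from the repeated endpoint.
Acyclic : ∀ {n} → Graph n → Set
Acyclic G = ∀ u vs → 2 ≤ length vs → Unique (u ∷ vs) →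
            ¬ Linked (Adj G) (u ∷ (vs ∷ʳ u))

IsTree : ∀ {n} → Graph n → Set
IsTree G = Connected G × Acyclic G

IsCotree : ∀ {n} → Graph n → Set
IsCotree G = IsTree (complement G)

module _ {n : ℕ} (G : Graph n) where

  Proper : ∀ {t} → (Fin n → Fin t) → Set
  Proper c = ∀ u v → Adj G u v → c u ≢ c v

  IsBVertex : ∀ {t} → (Fin n → Fin t) → Fin n → Set
  IsBVertex c v = ∀ j → j ≢ c v → ∃[ u ] (c u ≡ j × Adj G v u)

  IsBColoring : ∀ {t} → (Fin n → Fin t) → Set
  IsBColoring c = Proper c × (∀ i → ∃[ v ] (c v ≡ i × IsBVertex c v))

  HasBColoring : ℕ → Set
  HasBColoring t = ∃[ c ] IsBColoring {t} c

  IsBChromaticNumber : ℕ → Set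
  IsBChromaticNumber t = HasBColoring t × (∀ s → HasBColoring s → s ≤ t)

-- The model of computation is the WHILE language on binary trees of N. D. Jones
-- (Computability and Complexity from a Programming Perspective, MIT Press 1997),
-- with its unit-cost time measure: one unit per operator evaluated or command executed.
-- A program is a fixed command over finitely many variables.  Since each
-- operation creates at most one cell and follows at most one pointer when trees
-- are kept as shared structures, polynomial time in this model coincides with
-- polynomial time on Turing machines, even if unfolded trees get large.

data Tree : Set where
  nil  : Tree
  cons : Tree → Tree → Tree

head tail : Tree → Tree
head nil        = nil
head (cons x _) = x
tail nil        = nil
tail (cons _ y) = y

size : Tree → ℕ
size nil        = 1
size (cons x y) = suc (size x + size y)

data Expr (k : ℕ) : Set where
  var   : Fin k → Expr k
  nil   : Expr k
  cons  : Expr k → Expr k → Expr k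
  hd tl : Expr k → Expr k

infixr 4 _⨾_
infix  5 _≔_

data Cmd (k : ℕ) : Set where
  skip          : Cmd k
  _≔_           : Fin k → Expr k → Cmd k
  _⨾_           : Cmd k → Cmd k → Cmd k
  if_then_else_ : Expr k → Cmd k → Cmd k → Cmd k
  while_loop_   : Expr k → Cmd k → Cmd k

Store : ℕ → Set
Store k = Vec Tree k

eval : ∀ {k} → Expr k → Store k → Tree
eval (var x)    σ = lookup σ x
eval nil        σ = nil
eval (cons e f) σ = cons (eval e σ) (eval f σ)
eval (hd e)     σ = head (eval e σ)
eval (tl e)     σ = tail (eval e σ)

cost : ∀ {k} → Expr k → ℕ
cost (var _)    = 1
cost nil        = 1
cost (cons e f) = suc (cost e + cost f)
cost (hd e)     = suc (cost e)
cost (tl e)     = suc (cost e)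

-- c , σ ⇓[ t ] τ : started in store σ, the command c halts in store τ after
-- time t.  In tests, nil is false and every other tree is true.
infix 3 _,_⇓[_]_

data _,_⇓[_]_ {k : ℕ} : Cmd k → Store k → ℕ → Store k → Set where
  ⇓-skip : ∀ {σ} → skip , σ ⇓[ 1 ] σ

  ⇓-≔ : ∀ {x e σ} → x ≔ e , σ ⇓[ suc (cost e) ] σ [ x ]≔ eval e σ

  ⇓-⨾ : ∀ {c d σ τ υ s t} →
        c , σ ⇓[ s ] τ → d , τ ⇓[ t ] υ → c ⨾ d , σ ⇓[ suc (s + t) ] υ

  ⇓-then : ∀ {e c d σ τ t} → eval e σ ≢ nil → c , σ ⇓[ t ] τ →
           if e then c else d , σ ⇓[ suc (cost e + t) ] τ

  ⇓-else : ∀ {e c d σ τ t} → eval e σ ≡ nil → d , σ ⇓[ t ] τ →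
           if e then c else d , σ ⇓[ suc (cost e + t) ] τ

  ⇓-stop : ∀ {e c σ} → eval e σ ≡ nil →
           while e loop c , σ ⇓[ suc (cost e) ] σ

  ⇓-loop : ∀ {e c σ τ υ s t} → eval e σ ≢ nil →
           c , σ ⇓[ s ] τ → while e loop c , τ ⇓[ t ] υ →
           while e loop c , σ ⇓[ suc (cost e + (s + t)) ] υ

-- Variable zero holds the input at the start (all others hold nil) and the
-- output at the end.
record Program : Set where
  field
    {auxiliary} : ℕ
    body        : Cmd (suc auxiliary)

open Program public

Runs : Program → (input output : Tree) (time : ℕ) → Set
Runs p x y t =
  ∃[ τ ] ((body p , x ∷ replicate (auxiliary p) nil ⇓[ t ] τ) × lookup τ zero ≡ y)

fromList : List Tree → Tree
fromList = foldr cons nil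

fromBool : Bool → Tree
fromBool false = nil
fromBool true  = cons nil nil

-- Unary numerals: for outputs at most the number of vertices, the choice
-- between unary and binary does not affect polynomial time.
fromℕ : ℕ → Tree
fromℕ zero    = nil
fromℕ (suc m) = cons nil (fromℕ m)

adjacencyMatrix : ∀ {n} → Graph n → Tree
adjacencyMatrix G =
  fromList (tabulate λ u → fromList (tabulate λ v → fromBool (adj G u v)))

module Submission where

-- Let T be the complement of G, a tree.  Colour classes are cliques of T, so a proper
-- colouring is a matching of T, and as T has no triangles a vertex is a b-vertex iff none
-- of its T-neighbours is alone in its class.  Choosing a b-vertex in every class turns
-- b-colourings with t colours into assignments of states to vertices, in which n ∸ t
-- vertices are not chosen; so the b-chromatic number is n minus the least cost of such an
-- assignment.  The least cost is found by dynamic programming: a vertex with at most one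
-- remaining neighbour, which exists as T is acyclic, is eliminated and its table of least
-- costs is merged into the table of that neighbour.  An assignment of finite cost exists
-- because every graph has a b-colouring: a class without b-vertices can be dissolved into
-- the other classes.  As all loops are bounded by the number of vertices and operations
-- have unit cost, the running time is polynomial whatever the values computed.

-- A loop runs once per vertex, so numbers can be compared only up to n. Weights are therefore
-- represented up to truncation at n, and n itself serves as infinity; nothing is lost, because
-- `n ∸ a` depends on `n ⊓ a` alone. A class of two vertices is an edge of T. When one end is
-- eliminated, the other end only has to remember that it is matched, which is what the states
-- ending in 1 record; all conditions are thus local to edges. No elimination order is computed.
-- There are n rounds, each visiting every vertex and eliminating it if it has at most one remaining
-- neighbour; a round that eliminates nothing finds two remaining neighbours at every remaining
-- vertex, which in a forest leaves no vertex at all. Optimality is not expressed by a minimum over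
-- assignments: the invariant is the set of all k such that some assignment costs at most k, and
-- every elimination preserves this set.

open import Data.Nat.Properties hiding (_≟_; _≤?_; suc-injective)
open import Algebra.Properties.CommutativeMonoid.Sum +-0-commutativeMonoid
  using (sum; sum-remove; sum-cong-≗; sum-replicate-zero)
open import Data.Bool using (Bool; true; false; T; T?) renaming (if_then_else_ to choose)
open import Data.Empty using (⊥; ⊥-elim)
open import Data.Fin using (Fin; zero; suc; toℕ; fromℕ<; punchOut)
open import Data.Fin.Properties
  using (_≟_; injective⇒≤; any?; all?; ¬∀⟶∃¬; punchInᵢ≢i; punchOut-injective;
         suc-injective; toℕ-injective; toℕ<n; toℕ-fromℕ<)
open import Data.List using (List; []; _∷_; _∷ʳ_; _++_; allFin; filter; foldr; length; lookup; tabulate)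
open import Data.List.Membership.Propositional using (_∈_)
open import Data.List.Membership.Propositional.Properties using (∈-∃++; ∈-allFin; ∈-filter⁺; ∈-filter⁻; ∈-lookup)
open import Data.List.NonEmpty using (List⁺; _∷_; toList)
open import Data.List.Relation.Unary.All as All using (All; []; _∷_)
open import Data.List.Relation.Unary.All.Properties using (++⁻ˡ; ¬Any⇒All¬)
open import Data.List.Relation.Unary.AllPairs using ([]; _∷_)
open import Data.List.Relation.Unary.Any as Any using (here; there)
open import Data.List.Relation.Unary.Any.Properties using (lookup-index)
open import Data.List.Relation.Unary.Linked using (Linked; []; [-]; _∷_)
open import Data.List.Relation.Unary.Unique.Propositional using (Unique)
open import Data.List.Relation.Unary.Unique.Propositional.Properties using (allFin⁺; filter⁺)
open import Data.Maybe using (Maybe; just; nothing; is-just; map)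
open import Data.Nat using (ℕ; zero; suc; _+_; _*_; _^_; _∸_; _≤_; _<_; _⊓_; _⊔_; z≤n; s≤s; _≤?_; >-nonZero)
open import Data.Product using (∃-syntax; _×_; _,_; proj₁; proj₂)
open import Data.Sum using (_⊎_; inj₁; inj₂)
open import Data.Unit using (⊤; tt)
open import Data.Vec using ([]; _∷_; _[_]≔_)
open import Data.Vec.Functional using (removeAt; updateAt)
open import Data.Vec.Functional.Properties using (updateAt-updates; updateAt-minimal)
open import Function using (const; _⇔_; mk⇔; Equivalence)
open import Function.Construct.Composition using (_⇔-∘_)
open import Function.Construct.Identity using (⇔-id)
open import Relation.Binary.PropositionalEquality
open import Relation.Nullary using (¬_; Dec; yes; no; contradiction; Reflects; ofʸ; ofⁿ)
open import Relation.Nullary.Decidable using (_×-dec_; _→-dec_; ¬?; decidable-stable)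
open import Relation.Unary using (Decidable)
open import Defs

-- Bounded loop programs and their compilation

-- The bodies of loops receive a loop index, whose spine runs from n ∸ 1 down to
-- 0 for n the length of the input, an accumulator, and the argument of the loop.
data Fn : Set where
  arg input nil : Fn
  hd tl         : Fn → Fn
  cons          : Fn → Fn → Fn
  ite           : Fn → Fn → Fn → Fn
  _∘_           : Fn → Fn → Fn
  loop          : Fn → Fn → Fn

infixr 9 _∘_

truth : Tree → Bool
truth nil        = false
truth (cons _ _) = true

repeat : (Tree → Tree → Tree) → Tree → Tree → Tree
repeat h nil        a = a
repeat h (cons _ i) a = repeat h i (h i a)

⟦_⟧ : Fn → Tree → Tree → Tree
⟦ arg       ⟧ z x = x
⟦ input     ⟧ z x = z
⟦ nil       ⟧ z x = nil
⟦ hd f      ⟧ z x = head (⟦ f ⟧ z x)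
⟦ tl f      ⟧ z x = tail (⟦ f ⟧ z x)
⟦ cons f g  ⟧ z x = cons (⟦ f ⟧ z x) (⟦ g ⟧ z x)
⟦ ite e f g ⟧ z x = choose (truth (⟦ e ⟧ z x)) (⟦ f ⟧ z x) (⟦ g ⟧ z x)
⟦ g ∘ f     ⟧ z x = ⟦ g ⟧ z (⟦ f ⟧ z x)
⟦ loop f g  ⟧ z x = repeat (λ i a → ⟦ g ⟧ z (cons i (cons a x))) z (⟦ f ⟧ z x)

spine : Tree → ℕ
spine nil        = 0
spine (cons _ x) = suc (spine x)

spine<size : ∀ x → spine x < size x
spine<size nil        = ≤-refl
spine<size (cons x y) = s≤s (≤-trans (spine<size y) (m≤n+m (size y) (size x)))

infix 3 _,_⇓≤[_]_

-- Exact times depend on the branches taken; upper bounds compose along the syntax.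
_,_⇓≤[_]_ : ∀ {k} → Cmd k → Store k → ℕ → Store k → Set
c , σ ⇓≤[ T ] τ = ∃[ t ] ((c , σ ⇓[ t ] τ) × t ≤ T)

-- An upper bound on the running time if every loop is run at most n times.
bound : ∀ {k} → ℕ → Cmd k → ℕ
bound n skip                   = 1
bound n (x ≔ e)                = suc (cost e)
bound n (c ⨾ d)                = suc (bound n c + bound n d)
bound n (if e then c else d)   = suc (cost e + (bound n c + bound n d))
bound n (while e loop c)       = suc (cost e) + n * suc (cost e + bound n c)

module Timed (n : ℕ) {k : ℕ} where

  assign : ∀ {x} {e : Expr k} {σ} → x ≔ e , σ ⇓≤[ bound n (x ≔ e) ] σ [ x ]≔ eval e σ
  assign = _ , ⇓-≔ , ≤-refl

  infixr 4 _then_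

  _then_ : ∀ {c d : Cmd k} {σ τ υ} → c , σ ⇓≤[ bound n c ] τ → d , τ ⇓≤[ bound n d ] υ →
           c ⨾ d , σ ⇓≤[ bound n (c ⨾ d) ] υ
  (_ , p , s≤) then (_ , q , t≤) = _ , ⇓-⨾ p q , s≤s (+-mono-≤ s≤ t≤)

  branch-true : ∀ {e : Expr k} {c d σ τ} → eval e σ ≢ nil → c , σ ⇓≤[ bound n c ] τ →
                if e then c else d , σ ⇓≤[ bound n (if e then c else d) ] τ
  branch-true {e} e≢nil (_ , p , t≤) =
    _ , ⇓-then e≢nil p , s≤s (+-monoʳ-≤ (cost e) (≤-trans t≤ (m≤m+n _ _)))

  branch-false : ∀ {e : Expr k} {c d σ τ} → eval e σ ≡ nil → d , σ ⇓≤[ bound n d ] τ →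
                 if e then c else d , σ ⇓≤[ bound n (if e then c else d) ] τ
  branch-false {e} {c} e≡nil (_ , p , t≤) =
    _ , ⇓-else e≡nil p , s≤s (+-monoʳ-≤ (cost e) (≤-trans t≤ (m≤n+m _ (bound n c))))

acc stack clock : Fin 3
acc   = zero
stack = suc zero
clock = suc (suc zero)

-- Calling convention: argument and result are in `acc`, intermediate values are pushed on `stack`,
-- which is restored on exit, and `clock` keeps the input throughout. The stack makes three
-- variables enough for every nesting depth.
compile : Fn → Cmd 3
advance : Fn → Cmd 3

compile arg         = skip
compile input       = acc ≔ var clock
compile nil         = acc ≔ nil
compile (hd f)      = compile f ⨾ acc ≔ hd (var acc)
compile (tl f)      = compile f ⨾ acc ≔ tl (var acc)
compile (cons f g)  =
  stack ≔ cons (var acc) (var stack) ⨾ compile f ⨾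
  stack ≔ cons (hd (var stack)) (cons (var acc) (tl (var stack))) ⨾
  acc ≔ hd (var stack) ⨾ stack ≔ tl (var stack) ⨾ compile g ⨾
  acc ≔ cons (hd (var stack)) (var acc) ⨾ stack ≔ tl (var stack)
compile (ite e f g) =
  stack ≔ cons (var acc) (var stack) ⨾ compile e ⨾
  stack ≔ cons (var acc) (var stack) ⨾ acc ≔ hd (tl (var stack)) ⨾
  if hd (var stack)
    then stack ≔ tl (tl (var stack)) ⨾ compile f
    else (stack ≔ tl (tl (var stack)) ⨾ compile g)
compile (g ∘ f)     = compile f ⨾ compile g
compile (loop f g)  =
  stack ≔ cons (var acc) (var stack) ⨾ compile f ⨾
  -- The copy of the input on top of the stack is the loop counter; the argument of the loop lies
  -- below it, within reach of `advance`.
  stack ≔ cons (var clock) (var stack) ⨾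
  while hd (var stack) loop (advance g) ⨾
  stack ≔ tl (tl (var stack))

advance g =
  stack ≔ cons (tl (hd (var stack))) (tl (var stack)) ⨾
  acc ≔ cons (hd (var stack)) (cons (var acc) (hd (tl (var stack)))) ⨾
  compile g

while-bound : ∀ a b k {s t} → s ≤ b → t ≤ suc a + k * suc (a + b) →
              suc (a + (s + t)) ≤ suc a + suc k * suc (a + b)
while-bound a b k {s} {t} s≤ t≤ = s≤s (+-monoʳ-≤ a (begin
  s + t                                  ≤⟨ +-mono-≤ s≤ t≤ ⟩
  b + (suc a + k * suc (a + b))          ≡⟨ +-assoc b (suc a) _ ⟨
  b + suc a + k * suc (a + b)            ≡⟨ cong (_+ k * suc (a + b)) (+-comm b (suc a)) ⟩
  suc k * suc (a + b)                    ∎))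
  where open ≤-Reasoning

module _ (z : Tree) where

  private n = spine z
  open Timed n

  compile-runs : ∀ f x s →
    compile f , x ∷ s ∷ z ∷ [] ⇓≤[ bound n (compile f) ] ⟦ f ⟧ z x ∷ s ∷ z ∷ []

  -- Generalised over the counter `i` for the induction; at `i` equal to `z` the time is the `bound`
  -- of the loop. The constant 2 is the cost of the test `hd (var stack)`.
  compile-loops : ∀ g x s i a →
    while hd (var stack) loop (advance g) , a ∷ cons i (cons x s) ∷ z ∷ []
      ⇓≤[ suc 2 + spine i * suc (2 + bound n (advance g)) ]
    repeat (λ j b → ⟦ g ⟧ z (cons j (cons b x))) i a ∷ cons nil (cons x s) ∷ z ∷ []

  compile-runs arg         x s = _ , ⇓-skip , ≤-refl
  compile-runs input       x s = assign
  compile-runs nil         x s = assign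
  compile-runs (hd f)      x s = compile-runs f x s then assign
  compile-runs (tl f)      x s = compile-runs f x s then assign
  compile-runs (cons f g)  x s =
    assign then compile-runs f x _ then assign then assign then assign then
    compile-runs g x _ then assign then assign
  compile-runs (ite e f g) x s =
    assign then compile-runs e x _ then assign then assign then branch (⟦ e ⟧ z x)
    where
    branch : ∀ y →
      if hd (var stack) then stack ≔ tl (tl (var stack)) ⨾ compile f
                        else (stack ≔ tl (tl (var stack)) ⨾ compile g)
        , x ∷ cons y (cons x s) ∷ z ∷ [] ⇓≤[ _ ]
      choose (truth y) (⟦ f ⟧ z x) (⟦ g ⟧ z x) ∷ s ∷ z ∷ []
    branch nil        = branch-false refl (assign then compile-runs g x s)
    branch (cons _ _) = branch-true (λ ()) (assign then compile-runs f x s)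
  compile-runs (g ∘ f)     x s = compile-runs f x s then compile-runs g _ s
  compile-runs (loop f g)  x s =
    assign then compile-runs f x _ then assign then
    compile-loops g x s z (⟦ f ⟧ z x) then assign

  compile-loops g x s nil        a = _ , ⇓-stop refl , ≤-refl
  compile-loops g x s (cons _ i) a
    with _ , p , p≤ ← assign then assign then compile-runs g (cons i (cons a x)) (cons i (cons x s))
    with _ , q , q≤ ← compile-loops g x s i (⟦ g ⟧ z (cons i (cons a x)))
    = _ , ⇓-loop (λ ()) p q , while-bound 2 (bound n (advance g)) (spine i) p≤ q≤

-- Stated for every m above n so that it applies to n = `spine x` and m = `size x`. Such an m is
-- positive, which allows exponents to be raised to a common one.
Polynomial : (ℕ → ℕ) → Set
Polynomial h = ∃[ c ] ∃[ d ] (∀ {n m} → n < m → h n ≤ c * m ^ d)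

poly-const : ∀ a → Polynomial (λ _ → a)
poly-const a = a , 0 , λ _ → ≤-reflexive (sym (*-identityʳ a))

poly-id : Polynomial (λ n → n)
poly-id = 1 , 1 , λ {n} {m} n<m →
  ≤-trans (<⇒≤ n<m) (≤-reflexive (sym (trans (+-identityʳ (m * 1)) (*-identityʳ m))))

poly-+ : ∀ {g h} → Polynomial g → Polynomial h → Polynomial (λ n → g n + h n)
poly-+ {g} {h} (c , d , g≤) (c′ , d′ , h≤) = c + c′ , d + d′ , λ {n} {m} n<m →
  let instance _ = >-nonZero (≤-<-trans z≤n n<m) in begin
  g n + h n                             ≤⟨ +-mono-≤ (g≤ n<m) (h≤ n<m) ⟩
  c * m ^ d + c′ * m ^ d′               ≤⟨ +-mono-≤ (*-monoʳ-≤ c (^-monoʳ-≤ m (m≤m+n d d′)))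
                                                    (*-monoʳ-≤ c′ (^-monoʳ-≤ m (m≤n+m d′ d))) ⟩
  c * m ^ (d + d′) + c′ * m ^ (d + d′)  ≡⟨ *-distribʳ-+ (m ^ (d + d′)) c c′ ⟨
  (c + c′) * m ^ (d + d′)               ∎
  where open ≤-Reasoning

poly-* : ∀ {g h} → Polynomial g → Polynomial h → Polynomial (λ n → g n * h n)
poly-* {g} {h} (c , d , g≤) (c′ , d′ , h≤) = c * c′ , d + d′ , λ {n} {m} n<m → begin
  g n * h n                     ≤⟨ *-mono-≤ (g≤ n<m) (h≤ n<m) ⟩
  (c * m ^ d) * (c′ * m ^ d′)   ≡⟨ [m*n]*[o*p]≡[m*o]*[n*p] c (m ^ d) c′ (m ^ d′) ⟩
  (c * c′) * (m ^ d * m ^ d′)   ≡⟨ cong (c * c′ *_) (^-distribˡ-+-* m d d′) ⟨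
  c * c′ * m ^ (d + d′)         ∎
  where open ≤-Reasoning

poly-bound : ∀ {k} (c : Cmd k) → Polynomial (λ n → bound n c)
poly-bound skip                 = poly-const 1
poly-bound (x ≔ e)              = poly-const (suc (cost e))
poly-bound (c ⨾ d)              = poly-+ (poly-const 1) (poly-+ (poly-bound c) (poly-bound d))
poly-bound (if e then c else d) =
  poly-+ (poly-const (suc (cost e))) (poly-+ (poly-bound c) (poly-bound d))
poly-bound (while e loop c)     =
  poly-+ (poly-const (suc (cost e)))
         (poly-* poly-id (poly-+ (poly-const (suc (cost e))) (poly-bound c)))

program : Fn → Program
program f = record { auxiliary = 2 ; body = clock ≔ var acc ⨾ compile f }

program-polytime : ∀ f → ∃[ c ] ∃[ d ] (∀ x →
  ∃[ t ] (Runs (program f) x (⟦ f ⟧ x x) t × t ≤ c * size x ^ d + c))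
program-polytime f with c , d , poly ← poly-bound (body (program f)) = c , d , λ x →
  let open Timed (spine x)
      t , run , t≤ = assign then compile-runs x f x nil
  in t , (_ , run , refl) , ≤-trans t≤ (≤-trans (poly (spine<size x)) (m≤m+n _ c))

-- Sums and least values

m+o+n≡m+[n+o] : ∀ m n o → m + o + n ≡ m + (n + o)
m+o+n≡m+[n+o] m n o = trans (+-assoc m o n) (cong (m +_) (+-comm o n))

-- The addends `a` and `b` absorb the difference at `v`, so that no truncated subtraction enters.
sum-mono₁ : ∀ {n} {f g : Fin n → ℕ} {a b} v → (∀ w → w ≢ v → f w ≡ g w) →
            f v + a ≤ g v + b → sum f + a ≤ sum g + b
sum-mono₁ {suc n} {f} {g} {a} {b} v agree le = begin
  sum f + a      ≡⟨ cong (_+ a) (trans (sum-remove {i = v} f) (+-comm (f v) _)) ⟩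
  rest f + f v + a ≡⟨ +-assoc (rest f) (f v) a ⟩
  rest f + (f v + a) ≤⟨ +-mono-≤ (≤-reflexive (sum-cong-≗ λ w → agree _ (punchInᵢ≢i v w))) le ⟩
  rest g + (g v + b) ≡⟨ +-assoc (rest g) (g v) b ⟨
  rest g + g v + b ≡⟨ cong (_+ b) (trans (sum-remove {i = v} g) (+-comm (g v) _)) ⟨
  sum g + b      ∎
  where
  open ≤-Reasoning
  rest : (Fin (suc n) → ℕ) → ℕ
  rest h = sum (removeAt h v)

set : ∀ {n} {A : Set} → Fin n → A → (Fin n → A) → Fin n → A
set v x f = updateAt f v (const x)

set-≡ : ∀ {n} {A : Set} (v : Fin n) {x : A} f → set v x f v ≡ x
set-≡ v f = updateAt-updates v f

set-≢ : ∀ {n} {A : Set} (v : Fin n) {x : A} f {w} → w ≢ v → set v x f w ≡ f w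
set-≢ v f {w} w≢v = updateAt-minimal w v f w≢v

sum-mono₂ : ∀ {n} {f g : Fin n → ℕ} {v p} → v ≢ p → (∀ w → w ≢ v → w ≢ p → f w ≡ g w) →
            f v + f p ≤ g v + g p → sum f ≤ sum g
sum-mono₂ {f = f} {g} {v} {p} v≢p agree le = +-cancelʳ-≤ (g v) (sum f) (sum g) (begin
  sum f + g v  ≤⟨ sum-mono₁ v (λ w w≢v → sym (set-≢ v f w≢v))
                   (≤-reflexive (trans (+-comm (f v) (g v)) (cong (_+ f v) (sym (set-≡ v f))))) ⟩
  sum h + f v  ≤⟨ sum-mono₁ p h≗g (subst (λ x → x + f v ≤ g p + g v) (sym (set-≢ v f (≢-sym v≢p)))
                   (subst₂ _≤_ (+-comm (f v) (f p)) (+-comm (g v) (g p)) le)) ⟩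
  sum g + g v  ∎)
  where
  open ≤-Reasoning
  -- `h` differs from `f` only at `v` and from `g` only at `p`, so two changes at single vertices
  -- lead from `f` to `g`; the surplus `g v` cancels.
  h = set v (g v) f
  h≗g : ∀ w → w ≢ p → h w ≡ g w
  h≗g w w≢p with w ≟ v
  ... | yes refl = set-≡ v f
  ... | no w≢v   = trans (set-≢ v f w≢v) (agree w w≢v w≢p)

least : ∀ {A : Set} → (A → ℕ) → List⁺ A → ℕ
least h (x ∷ ys) = foldr (λ y m → h y ⊓ m) (h x) ys

least-≤ : ∀ {A : Set} (h : A → ℕ) {x} ys → x ∈ toList ys → least h ys ≤ h x
least-≤ h (x ∷ [])     (here refl)         = ≤-refl
least-≤ h (x ∷ y ∷ ys) (here refl)         = ≤-trans (m⊓n≤n (h y) _) (least-≤ h (x ∷ ys) (here refl))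
least-≤ h (x ∷ y ∷ ys) (there (here refl)) = m⊓n≤m (h y) _
least-≤ h (x ∷ y ∷ ys) (there (there i))   = ≤-trans (m⊓n≤n (h y) _) (least-≤ h (x ∷ ys) (there i))

least-attained : ∀ {A : Set} (h : A → ℕ) ys → ∃[ x ] (x ∈ toList ys × h x ≡ least h ys)
least-attained h (x ∷ [])     = x , here refl , refl
least-attained h (x ∷ y ∷ ys) with ⊓-sel (h y) (least h (x ∷ ys)) | least-attained h (x ∷ ys)
... | inj₁ eq | _                  = y , there (here refl) , sym eq
... | inj₂ eq | z , here refl , eq′ = z , here refl , trans eq′ (sym eq)
... | inj₂ eq | z , there i , eq′   = z , there (there i) , trans eq′ (sym eq)

-- Elimination of leaves

-- U: a b-vertex that is alone in its colour class; A: a b-vertex whose class has a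
-- second vertex; B: such a second vertex.  A vertex in state A0 or B0 still has to
-- be matched with the other vertex of its class, one in state A1 or B1 has been
-- matched with a vertex that is already eliminated.
data St : Set where
  A0 A1 B0 B1 U : St

Open : St → Set
Open A0 = ⊤
Open A1 = ⊥
Open B0 = ⊤
Open B1 = ⊥
Open U  = ⊥

-- The letter refers to the states `B0` and `B1` of vertices that are not chosen, rather than to
-- b-vertices.
IsB : St → Set
IsB A0 = ⊥
IsB A1 = ⊥
IsB B0 = ⊤
IsB B1 = ⊤
IsB U  = ⊥

data Mate : St → St → Set where
  ab : Mate A0 B0
  ba : Mate B0 A0

close : St → St
close A0 = A1
close A1 = A1
close B0 = B1
close B1 = B1
close U  = U

mate-openˡ : ∀ {r s} → Mate r s → Open r
mate-openˡ ab = tt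
mate-openˡ ba = tt

mate-sym : ∀ {r s} → Mate r s → Mate s r
mate-sym ab = ba
mate-sym ba = ab

mate-≢Uˡ : ∀ {r s} → Mate r s → r ≢ U
mate-≢Uˡ ab ()
mate-≢Uˡ ba ()

open? : ∀ s → Open s ⊎ ¬ Open s
open? A0 = inj₁ tt
open? A1 = inj₂ λ ()
open? B0 = inj₁ tt
open? B1 = inj₂ λ ()
open? U  = inj₂ λ ()

-- Merge r s x: a vertex in state r that is eliminated next to a vertex in state s
-- leaves the latter in state x.
data Merge : St → St → St → Set where
  unmatched : ∀ {r s} → ¬ Open r → (r ≡ U → IsB s) → (s ≡ U → IsB r) → Merge r s s
  matched   : ∀ {r s} → Mate r s → Merge r s (close s)

-- `Merge` read backwards, from the resulting state to the pairs that produce it. No list is empty,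
-- so a merged table has an entry for every state.
options : St → List⁺ (St × St)
options A0 = (A1 , A0) ∷ (B1 , A0) ∷ []
options A1 = (A1 , A1) ∷ (B1 , A1) ∷ (B0 , A0) ∷ []
options B0 = (A1 , B0) ∷ (B1 , B0) ∷ (U , B0) ∷ []
options B1 = (A1 , B1) ∷ (B1 , B1) ∷ (U , B1) ∷ (A0 , B0) ∷ []
options U  = (B1 , U) ∷ []

merge⇒option : ∀ {r s x} → Merge r s x → (r , s) ∈ toList (options x)
merge⇒option (matched ab) = there (there (there (here refl)))
merge⇒option (matched ba) = there (there (here refl))
merge⇒option {A0}      (unmatched c _ _) = contradiction tt c
merge⇒option {B0}      (unmatched c _ _) = contradiction tt c
merge⇒option {A1} {A0} (unmatched _ _ _) = here refl
merge⇒option {A1} {A1} (unmatched _ _ _) = here refl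
merge⇒option {A1} {B0} (unmatched _ _ _) = here refl
merge⇒option {A1} {B1} (unmatched _ _ _) = here refl
merge⇒option {A1} {U}  (unmatched _ _ q) = ⊥-elim (q refl)
merge⇒option {B1} {A0} (unmatched _ _ _) = there (here refl)
merge⇒option {B1} {A1} (unmatched _ _ _) = there (here refl)
merge⇒option {B1} {B0} (unmatched _ _ _) = there (here refl)
merge⇒option {B1} {B1} (unmatched _ _ _) = there (here refl)
merge⇒option {B1} {U}  (unmatched _ _ _) = here refl
merge⇒option {U}  {A0} (unmatched _ p _) = ⊥-elim (p refl)
merge⇒option {U}  {A1} (unmatched _ p _) = ⊥-elim (p refl)
merge⇒option {U}  {B0} (unmatched _ _ _) = there (there (here refl))
merge⇒option {U}  {B1} (unmatched _ _ _) = there (there (here refl))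
merge⇒option {U}  {U}  (unmatched _ p _) = ⊥-elim (p refl)

options-merge : ∀ x → All (λ (r , s) → Merge r s x) (toList (options x))
options-merge A0 = unmatched (λ ()) (λ ()) (λ ()) ∷ unmatched (λ ()) (λ ()) (λ ()) ∷ []
options-merge A1 = unmatched (λ ()) (λ ()) (λ ()) ∷ unmatched (λ ()) (λ ()) (λ ()) ∷ matched ba ∷ []
options-merge B0 = unmatched (λ ()) (λ ()) (λ ()) ∷ unmatched (λ ()) (λ ()) (λ ()) ∷
                   unmatched (λ ()) (λ _ → tt) (λ ()) ∷ []
options-merge B1 = unmatched (λ ()) (λ ()) (λ ()) ∷ unmatched (λ ()) (λ ()) (λ ()) ∷
                   unmatched (λ ()) (λ _ → tt) (λ ()) ∷ matched ab ∷ []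
options-merge U  = unmatched (λ ()) (λ ()) (λ _ → tt) ∷ []

merge-≢U : ∀ {r s x} → Merge r s x → x ≡ U → s ≡ U
merge-≢U (unmatched _ _ _) eq = eq
merge-≢U (matched ab) ()
merge-≢U (matched ba) ()

merge-IsB : ∀ {r s x} → Merge r s x → IsB s → IsB x
merge-IsB (unmatched _ _ _) b = b
merge-IsB (matched ab) b = tt

merge-IsB⁻ : ∀ {r s x} → Merge r s x → IsB x → IsB s
merge-IsB⁻ (unmatched _ _ _) b = b
merge-IsB⁻ (matched ab) b = tt
merge-IsB⁻ (matched ba) ()

mate-closed : ∀ {r s} → Mate r s → ¬ Open (close s)
mate-closed ab ()
mate-closed ba ()

Table : Set
Table = St → ℕ

cost-of : Table → Table → St × St → ℕ
cost-of f g (r , s) = f r + g s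

merge : Table → Table → Table
merge f g x = least (cost-of f g) (options x)

-- A vertex without remaining neighbours can no longer be matched, so states that still await a mate
-- are excluded.
closed : List⁺ St
closed = A1 ∷ B1 ∷ U ∷ []

best : Table → ℕ
best f = least f closed

closed-∈ : ∀ {r} → ¬ Open r → r ∈ toList closed
closed-∈ {A0} c = contradiction tt c
closed-∈ {A1} c = here refl
closed-∈ {B0} c = contradiction tt c
closed-∈ {B1} c = there (here refl)
closed-∈ {U}  c = there (there (here refl))

closed-¬Open : All (λ r → ¬ Open r) (toList closed)
closed-¬Open = (λ ()) ∷ (λ ()) ∷ (λ ()) ∷ []

-- Configurations and elimination steps

Tables : ℕ → Set
Tables n = Fin n → Maybe Table

Alive : ∀ {n} → Tables n → Fin n → Set
Alive g v = T (is-just (g v))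

weight : Maybe Table → St → ℕ
weight nothing  _ = 0
weight (just f) s = f s

-- The number is the cost settled so far: an isolated vertex carries the least costs of a whole
-- component and has no neighbour to pass them on to.
DPState : ℕ → Set
DPState n = ℕ × Tables n

adj-sym : ∀ {n} (H : Graph n) {u v} → Adj H u v → Adj H v u
adj-sym H {u} {v} = subst T (symmetric H u v)

adj-≢ : ∀ {n} (H : Graph n) {u v} → Adj H u v → u ≢ v
adj-≢ H {u} a refl = subst T (loopless H u) a

module _ {n : ℕ} (H : Graph n) where

  Nbr : Tables n → Fin n → Fin n → Set
  Nbr g v w = Adj H v w × Alive g w

  -- An assignment of states as seen by the remaining vertices. The involution makes the pairs of
  -- mates disjoint. `lonely` is the b-vertex condition: a chosen vertex next to `u` in T would miss
  -- the class that consists of `u` alone.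
  record Config (g : Tables n) : Set where
    field
      state   : Fin n → St
      partner : Fin n → Fin n
      mated   : ∀ {v} → Alive g v → Open (state v) →
                Nbr g v (partner v) × partner (partner v) ≡ v × Mate (state v) (state (partner v))
      lonely  : ∀ {u v} → Alive g u → Alive g v → Adj H u v → state u ≡ U → IsB (state v)

  open Config

  total : ∀ {g} → Config g → ℕ
  total {g} C = sum (λ v → weight (g v) (state C v))

  Achieves : DPState n → ℕ → Set
  Achieves (a , g) k = ∃[ C ] total {g} C + a ≤ k

  -- The new tables are pinned down only through their values, which keeps the optimality argument
  -- apart from the function that the program computes.
  data Step (v : Fin n) : DPState n → DPState n → Set where
    dead     : ∀ {a g} → ¬ Alive g v → Step v (a , g) (a , g)
    branch   : ∀ {a g w w′} → Nbr g v w → Nbr g v w′ → w ≢ w′ → Step v (a , g) (a , g)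
    isolated : ∀ {a g g′ f} → g v ≡ just f → (∀ {w} → ¬ Nbr g v w) →
               g′ v ≡ nothing → (∀ {w} → w ≢ v → g′ w ≡ g w) → Step v (a , g) (a + best f , g′)
    leaf     : ∀ {a g g′ p f h} → g v ≡ just f → g p ≡ just h → Adj H v p →
               (∀ {w} → Nbr g v w → w ≡ p) → g′ v ≡ nothing → g′ p ≡ just (merge f h) →
               (∀ {w} → w ≢ v → w ≢ p → g′ w ≡ g w) → Step v (a , g) (a , g′)

  alive-just : ∀ {g : Tables n} {v f} → g v ≡ just f → Alive g v
  alive-just eq rewrite eq = tt

  alive-≡ : ∀ {g g′ : Tables n} {v} → g v ≡ g′ v → Alive g v → Alive g′ v
  alive-≡ eq = subst (λ x → T (is-just x)) eq

  alive-≢ : ∀ {g : Tables n} {v w} → g v ≡ nothing → Alive g w → w ≢ v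
  alive-≢ gv al refl rewrite gv = al

  module _ {v : Fin n} {g g′ : Tables n} {f : Table} (gv : g v ≡ just f) (none : ∀ {w} → ¬ Nbr g v w)
           (g′v : g′ v ≡ nothing) (rest : ∀ {w} → w ≢ v → g′ w ≡ g w) where

    -- An open state at `v` would need a mate among its neighbours, of which there are none; hence
    -- its state is one of those minimised by `best`.
    isolated-remove : ∀ {a k} → Achieves (a , g) k → Achieves (a + best f , g′) k
    isolated-remove {a} {k} (C , le) = C′ , ≤-trans
      (subst (_≤ total C + a) (m+o+n≡m+[n+o] (total C′) a (best f)) (+-monoˡ-≤ a total-≤)) le
      where
      old : ∀ {w} → Alive g′ w → Alive g w
      old al = alive-≡ {g′} {g} (rest (alive-≢ {g′} g′v al)) al
      new : ∀ {w} → w ≢ v → Alive g w → Alive g′ w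
      new w≢v = alive-≡ {g} {g′} (sym (rest w≢v))
      C′ : Config g′
      C′ .state   = state C
      C′ .partner = partner C
      C′ .mated {w} al op with (adj , al′) , inv , mt ← mated C (old al) op =
        (adj , new m≢v al′) , inv , mt
        where
        m≢v : partner C w ≢ v
        m≢v refl = none (adj-sym H adj , old al)
      C′ .lonely al al′ = lonely C (old al) (old al′)
      v-closed : ¬ Open (state C v)
      v-closed op = none (proj₁ (mated C (alive-just {g} gv) op))
      total-≤ : total C′ + best f ≤ total C
      total-≤ = subst (total C′ + best f ≤_) (+-identityʳ (total C))
        (sum-mono₁ v (λ w w≢v → cong (λ x → weight x (state C w)) (rest w≢v))
          (subst₂ (λ x y → weight x (state C v) + best f ≤ weight y (state C v) + 0) (sym g′v) (sym gv)
            (≤-trans (least-≤ f closed (closed-∈ v-closed)) (≤-reflexive (sym (+-identityʳ _))))))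

    -- The cheapest closed state at `v` is compatible with everything, as no remaining vertex is
    -- adjacent to `v`.
    isolated-insert : ∀ {a k} → Achieves (a + best f , g′) k → Achieves (a , g) k
    isolated-insert {a} {k} (C′ , le) with r , r∈ , fr ← least-attained f closed = C , ≤-trans
      (subst (total C + a ≤_) (m+o+n≡m+[n+o] (total C′) a (best f)) (+-monoˡ-≤ a total-≤)) le
      where
      s = set v r (state C′)
      new : ∀ {w} → w ≢ v → Alive g w → Alive g′ w
      new w≢v = alive-≡ {g} {g′} (sym (rest w≢v))
      old : ∀ {w} → Alive g′ w → Alive g w
      old al = alive-≡ {g′} {g} (rest (alive-≢ {g′} g′v al)) al
      s-other : ∀ {w} → w ≢ v → s w ≡ state C′ w
      s-other w≢v = set-≢ v (state C′) w≢v
      C : Config g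
      C .state   = s
      C .partner = partner C′
      C .mated {w} al op with w ≟ v
      ... | yes refl = contradiction (subst Open (set-≡ v (state C′)) op) (All.lookup closed-¬Open r∈)
      ... | no w≢v with (adj , al′) , inv , mt ← mated C′ (new w≢v al) (subst Open (s-other w≢v) op) =
        (adj , old al′) , inv , subst₂ Mate (sym (s-other w≢v)) (sym (s-other (alive-≢ {g′} g′v al′))) mt
      C .lonely {u} {w} al al′ adj eq with u ≟ v | w ≟ v
      ... | yes refl | _        = contradiction (adj , al′) none
      ... | no _     | yes refl = contradiction (adj-sym H adj , al) none
      ... | no u≢v   | no w≢v   = subst IsB (sym (s-other w≢v))
        (lonely C′ (new u≢v al) (new w≢v al′) adj (trans (sym (s-other u≢v)) eq))
      total-≤ : total C ≤ total C′ + best f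
      total-≤ = subst (_≤ total C′ + best f) (+-identityʳ (total C))
        (sum-mono₁ v (λ w w≢v → cong₂ weight (sym (rest w≢v)) (s-other w≢v))
          (≤-reflexive (trans (+-identityʳ _) (trans (cong₂ weight gv (set-≡ v (state C′)))
             (trans fr (cong (λ x → weight x (state C′ v) + best f) (sym g′v)))))))

  module _ {v p : Fin n} {g g′ : Tables n} {f h : Table} (gv : g v ≡ just f) (gp : g p ≡ just h)
           (vp : Adj H v p) (only : ∀ {w} → Nbr g v w → w ≡ p)
           (g′v : g′ v ≡ nothing) (g′p : g′ p ≡ just (merge f h))
           (rest : ∀ {w} → w ≢ v → w ≢ p → g′ w ≡ g w) where

    private
      v≢p : v ≢ p
      v≢p = adj-≢ H vp

      old : ∀ {w} → Alive g′ w → Alive g w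
      old {w} al with w ≟ p
      ... | yes refl = alive-just {g} gp
      ... | no w≢p   = alive-≡ {g′} {g} (rest (alive-≢ {g′} g′v al) w≢p) al

      new : ∀ {w} → w ≢ v → Alive g w → Alive g′ w
      new {w} w≢v al with w ≟ p
      ... | yes refl = alive-just {g′} g′p
      ... | no w≢p   = alive-≡ {g} {g′} (sym (rest w≢v w≢p)) al

      compare : ∀ {s s′ : Fin n → St} → (∀ {w} → w ≢ v → w ≢ p → s w ≡ s′ w) →
                ∀ w → w ≢ v → w ≢ p → weight (g w) (s w) ≡ weight (g′ w) (s′ w)
      compare agree w w≢v w≢p = cong₂ weight (sym (rest w≢v w≢p)) (agree w≢v w≢p)

    -- Shared by the matched and the unmatched case of `leaf-remove`. By `merge⇒option` the old
    -- states of `v` and `p` are among the pairs minimised for the new state `x` of `p`.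
    remove-with : ∀ {a k} → ((C , _) : Achieves (a , g) k) → ∀ {x} → Merge (state C v) (state C p) x →
      (let s′ = set p x (state C)) →
      (∀ {w} → w ≢ v → Alive g w → Open (s′ w) →
        partner C w ≢ v × Mate (s′ w) (s′ (partner C w)) × Open (state C w)) →
      Achieves (a , g′) k
    remove-with {a} (C , le) {x} mg mated-other = C′ , ≤-trans (+-monoˡ-≤ a total-≤) le
      where
      s′ = set p x (state C)
      C′ : Config g′
      C′ .state   = s′
      C′ .partner = partner C
      C′ .mated {w} al op with w≢v ← alive-≢ {g′} g′v al
                          with m≢v , mt , op′ ← mated-other w≢v (old al) op
                          with (adj , al′) , inv , _ ← mated C (old al) op′ =
        (adj , new m≢v al′) , inv , mt
      C′ .lonely {u} {w} al al′ adj eq = IsB′ w (lonely C (old al) (old al′) adj (U′ u eq))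
        where
        U′ : ∀ u → s′ u ≡ U → state C u ≡ U
        U′ u eq with u ≟ p
        ... | yes refl = merge-≢U mg (trans (sym (set-≡ p (state C))) eq)
        ... | no u≢p   = trans (sym (set-≢ p (state C) u≢p)) eq
        IsB′ : ∀ w → IsB (state C w) → IsB (s′ w)
        IsB′ w b with w ≟ p
        ... | yes refl = subst IsB (sym (set-≡ p (state C))) (merge-IsB mg b)
        ... | no w≢p   = subst IsB (sym (set-≢ p (state C) w≢p)) b
      total-≤ : total C′ ≤ total C
      total-≤ = sum-mono₂ v≢p (λ w w≢v w≢p → sym (compare (λ _ w≢p → sym (set-≢ p (state C) w≢p)) w w≢v w≢p)) le-vp
        where
        le-vp : weight (g′ v) (s′ v) + weight (g′ p) (s′ p) ≤ weight (g v) (state C v) + weight (g p) (state C p)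
        le-vp rewrite g′v | g′p | gv | gp | set-≡ p {x} (state C) =
          least-≤ (cost-of f h) (options x) (merge⇒option mg)

    leaf-remove : ∀ {a k} → Achieves (a , g) k → Achieves (a , g′) k
    leaf-remove {a} {k} (C , le) with open? (state C v)
    ... | inj₁ op = remove-with (C , le) (matched v~p) mated-other
      where
      partner-v : partner C v ≡ p
      partner-v = only (proj₁ (mated C (alive-just {g} gv) op))
      partner-p : partner C p ≡ v
      partner-p = subst (λ u → partner C u ≡ v) partner-v (proj₁ (proj₂ (mated C (alive-just {g} gv) op)))
      v~p : Mate (state C v) (state C p)
      v~p = subst (λ u → Mate (state C v) (state C u)) partner-v
              (proj₂ (proj₂ (mated C (alive-just {g} gv) op)))
      s′ = set p (close (state C p)) (state C)
      mated-other : ∀ {w} → w ≢ v → Alive g w → Open (s′ w) →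
                    partner C w ≢ v × Mate (s′ w) (s′ (partner C w)) × Open (state C w)
      mated-other {w} w≢v al o with w ≟ p
      ... | yes refl = contradiction (subst Open (set-≡ p (state C)) o) (mate-closed v~p)
      ... | no w≢p with o′ ← subst Open (set-≢ p (state C) w≢p) o
                   with (adj , _) , inv , mt ← mated C al o′ =
        -- A partner `v` would make `w` a neighbour of the leaf, hence equal to `p`; a partner `p`
        -- would make `w` equal to `v` by the involution.
        (λ eq → w≢p (only (adj-sym H (subst (Adj H w) eq adj) , al))) ,
        subst₂ Mate (sym (set-≢ p (state C) w≢p))
                    (sym (set-≢ p (state C) λ eq → w≢v (trans (sym inv) (trans (cong (partner C) eq) partner-p)))) mt ,
        o′
    ... | inj₂ cl = remove-with (C , le) (unmatched cl (lonely C (alive-just {g} gv) (alive-just {g} gp) vp)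
                                         (lonely C (alive-just {g} gp) (alive-just {g} gv) (adj-sym H vp)))
                    mated-other
      where
      s′ = set p (state C p) (state C)
      same : ∀ w → s′ w ≡ state C w
      same w with w ≟ p
      ... | yes refl = set-≡ p (state C)
      ... | no w≢p   = set-≢ p (state C) w≢p
      mated-other : ∀ {w} → w ≢ v → Alive g w → Open (s′ w) →
                    partner C w ≢ v × Mate (s′ w) (s′ (partner C w)) × Open (state C w)
      mated-other {w} w≢v al o with o′ ← subst Open (same w) o
                               with _ , _ , mt ← mated C al o′ =
        (λ eq → cl (mate-openˡ (mate-sym (subst (λ u → Mate (state C w) (state C u)) eq mt)))) ,
        subst₂ Mate (sym (same w)) (sym (same (partner C w))) mt , o′

    insert-with : ∀ {a k} → ((C′ , _) : Achieves (a , g′) k) → ∀ {r q} → Merge r q (state C′ p) →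
      f r + h q ≡ merge f h (state C′ p) → (let s = set v r (set p q (state C′))) → (m : Fin n → Fin n) →
      (∀ {w} → Alive g w → Open (s w) → Nbr g w (m w) × m (m w) ≡ w × Mate (s w) (s (m w))) →
      (r ≡ U → IsB q) → (q ≡ U → IsB r) → Achieves (a , g) k
    insert-with {a} (C′ , le) {r} {q} mg cost≡ m mated-all U-r U-q = C , ≤-trans (+-monoˡ-≤ a total-≤) le
      where
      s = set v r (set p q (state C′))
      s-v : s v ≡ r
      s-v = set-≡ v (set p q (state C′))
      s-p : s p ≡ q
      s-p = trans (set-≢ v (set p q (state C′)) (≢-sym v≢p)) (set-≡ p (state C′))
      s-other : ∀ {w} → w ≢ v → w ≢ p → s w ≡ state C′ w
      s-other w≢v w≢p = trans (set-≢ v (set p q (state C′)) w≢v) (set-≢ p (state C′) w≢p)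
      U′ : ∀ u → u ≢ v → s u ≡ U → state C′ u ≡ U
      U′ u u≢v eq with u ≟ p
      ... | yes refl = lemma (state C′ p) mg (trans (sym s-p) eq)
        where
        lemma : ∀ x → Merge r q x → q ≡ U → x ≡ U
        lemma _ (unmatched _ _ _) eq = eq
        lemma _ (matched mt) eq = contradiction eq (mate-≢Uˡ (mate-sym mt))
      ... | no u≢p   = trans (sym (s-other u≢v u≢p)) eq
      IsB′ : ∀ w → w ≢ v → IsB (state C′ w) → IsB (s w)
      IsB′ w w≢v b with w ≟ p
      ... | yes refl = subst IsB (sym s-p) (merge-IsB⁻ mg b)
      ... | no w≢p   = subst IsB (sym (s-other w≢v w≢p)) b
      C : Config g
      C .state   = s
      C .partner = m
      C .mated   = mated-all
      C .lonely {u} {w} al al′ adj eq with u ≟ v | w ≟ v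
      ... | yes refl | _        = subst IsB (sym (trans (cong s (only (adj , al′))) s-p)) (U-r (trans (sym s-v) eq))
      ... | no _     | yes refl = subst IsB (sym s-v)
        (U-q (trans (sym (trans (cong s (only (adj-sym H adj , al))) s-p)) eq))
      ... | no u≢v   | no w≢v   = IsB′ w w≢v (lonely C′ (new u≢v al) (new w≢v al′) adj (U′ u u≢v eq))
      total-≤ : total C ≤ total C′
      total-≤ = sum-mono₂ v≢p (compare s-other) le-vp
        where
        le-vp : weight (g v) (s v) + weight (g p) (s p) ≤ weight (g′ v) (state C′ v) + weight (g′ p) (state C′ p)
        le-vp rewrite g′v | g′p | gv | gp | s-v | s-p = ≤-reflexive cost≡

    -- The pair that attains the minimum in `merge` is put back on `v` and `p`. Only if the two are
    -- mates do partners change.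
    leaf-insert : ∀ {a k} → Achieves (a , g′) k → Achieves (a , g) k
    leaf-insert {a} {k} (C′ , le) with (r , q) , i , cost≡ ← least-attained (cost-of f h) (options (state C′ p)) =
      result (state C′ p) refl (All.lookup (options-merge (state C′ p)) i)
      where
      s = set v r (set p q (state C′))
      s-v : s v ≡ r
      s-v = set-≡ v (set p q (state C′))
      s-p : s p ≡ q
      s-p = trans (set-≢ v (set p q (state C′)) (≢-sym v≢p)) (set-≡ p (state C′))
      s-other : ∀ {w} → w ≢ v → w ≢ p → s w ≡ state C′ w
      s-other w≢v w≢p = trans (set-≢ v (set p q (state C′)) w≢v) (set-≢ p (state C′) w≢p)
      result : ∀ x → state C′ p ≡ x → Merge r q x → Achieves (a , g) k
      result x x≡ mg@(unmatched cl U-r U-q) =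
        insert-with (C′ , le) (subst (Merge r q) (sym x≡) mg) cost≡ (partner C′) mated-all U-r U-q
        where
        same : ∀ {w} → w ≢ v → s w ≡ state C′ w
        same {w} w≢v with w ≟ p
        ... | yes refl = trans s-p (sym x≡)
        ... | no w≢p   = s-other w≢v w≢p
        mated-all : ∀ {w} → Alive g w → Open (s w) →
                    Nbr g w (partner C′ w) × partner C′ (partner C′ w) ≡ w × Mate (s w) (s (partner C′ w))
        mated-all {w} al op with w ≟ v
        ... | yes refl = contradiction (subst Open s-v op) cl
        ... | no w≢v with (adj , al′) , inv , mt ← mated C′ (new w≢v al) (subst Open (same w≢v) op) =
          (adj , old al′) , inv , subst₂ Mate (sym (same w≢v)) (sym (same (alive-≢ {g′} g′v al′))) mt
      result x x≡ mg@(matched mt) =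
        insert-with (C′ , le) (subst (Merge r q) (sym x≡) mg) cost≡ m mated-all
          (λ eq → contradiction eq (mate-≢Uˡ mt)) (λ eq → contradiction eq (mate-≢Uˡ (mate-sym mt)))
        where
        m = set v p (set p v (partner C′))
        m-v : m v ≡ p
        m-v = set-≡ v (set p v (partner C′))
        m-p : m p ≡ v
        m-p = trans (set-≢ v (set p v (partner C′)) (≢-sym v≢p)) (set-≡ p (partner C′))
        m-other : ∀ {w} → w ≢ v → w ≢ p → m w ≡ partner C′ w
        m-other w≢v w≢p = trans (set-≢ v (set p v (partner C′)) w≢v) (set-≢ p (partner C′) w≢p)
        mated-all : ∀ {w} → Alive g w → Open (s w) → Nbr g w (m w) × m (m w) ≡ w × Mate (s w) (s (m w))
        mated-all {w} al op with w ≟ v | w ≟ p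
        ... | yes refl | _ = subst (λ u → Nbr g v u × m u ≡ v × Mate (s v) (s u)) (sym m-v)
          ((vp , alive-just {g} gp) , m-p , subst₂ Mate (sym s-v) (sym s-p) mt)
        ... | no _ | yes refl = subst (λ u → Nbr g p u × m u ≡ p × Mate (s p) (s u)) (sym m-p)
          ((adj-sym H vp , alive-just {g} gv) , m-v , subst₂ Mate (sym s-p) (sym s-v) (mate-sym mt))
        ... | no w≢v | no w≢p
            with (adj , al′) , inv , mt′ ← mated C′ (new w≢v al) (subst Open (s-other w≢v w≢p) op) =
          subst (λ u → Nbr g w u × m u ≡ w × Mate (s w) (s u)) (sym (m-other w≢v w≢p))
            ((adj , old al′) , trans (m-other m≢v m≢p) inv ,
             subst₂ Mate (sym (s-other w≢v w≢p)) (sym (s-other m≢v m≢p)) mt′)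
          where
          m≢v = alive-≢ {g′} g′v al′
          -- A matched merge leaves `p` closed in `C′`, whereas mates are open, so redirecting the
          -- partner of `p` robs no other vertex.
          m≢p : partner C′ w ≢ p
          m≢p eq = mate-closed mt (subst Open (trans (cong (state C′) eq) x≡) (mate-openˡ (mate-sym mt′)))

  step-achieves : ∀ {v S S′ k} → Step v S S′ → Achieves S k ⇔ Achieves S′ k
  step-achieves (dead _)         = ⇔-id _
  step-achieves (branch _ _ _)   = ⇔-id _
  step-achieves (isolated gv none g′v rest) =
    mk⇔ (isolated-remove gv none g′v rest) (isolated-insert gv none g′v rest)
  step-achieves (leaf gv gp vp only g′v g′p rest) =
    mk⇔ (leaf-remove gv gp vp only g′v g′p rest) (leaf-insert gv gp vp only g′v g′p rest)

-- A forest has a vertex with at most one neighbour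

lookup-injective : ∀ {A : Set} {xs : List A} → Unique xs → ∀ i j → lookup xs i ≡ lookup xs j → i ≡ j
lookup-injective (_  ∷ _)  zero    zero    _  = refl
lookup-injective (x∉ ∷ _)  zero    (suc j) eq = contradiction eq (All.lookup x∉ (∈-lookup j))
lookup-injective (x∉ ∷ _)  (suc i) zero    eq = contradiction (sym eq) (All.lookup x∉ (∈-lookup i))
lookup-injective (_  ∷ un) (suc i) (suc j) eq = cong suc (lookup-injective un i j eq)

unique-length-≤ : ∀ {n} {xs : List (Fin n)} → Unique xs → length xs ≤ n
unique-length-≤ un = injective⇒≤ (λ {i} {j} → lookup-injective un i j)

unique-++ˡ : ∀ {A : Set} (xs : List A) {ys} → Unique (xs ++ ys) → Unique xs
unique-++ˡ []       _         = []
unique-++ˡ (x ∷ xs) (x∉ ∷ un) = ++⁻ˡ xs x∉ ∷ unique-++ˡ xs un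

linked-close : ∀ {A : Set} {R : A → A → Set} {z u} xs {ys} →
               Linked R (xs ++ z ∷ ys) → R z u → Linked R ((xs ++ z ∷ []) ∷ʳ u)
linked-close []           _       zu = zu ∷ [-]
linked-close (x ∷ [])     (r ∷ _) zu = r ∷ zu ∷ [-]
linked-close (x ∷ y ∷ xs) (r ∷ l) zu = r ∷ linked-close (y ∷ xs) l zu

alive-1 : Maybe Table → ℕ
alive-1 nothing  = 0
alive-1 (just _) = 1

alive-count : ∀ {n} → Tables n → ℕ
alive-count g = sum (λ v → alive-1 (g v))

module _ {n : ℕ} (H : Graph n) where

  Stuck : Tables n → Fin n → Set
  Stuck g v = Alive g v → ∃[ w ] ∃[ w′ ] (Nbr H g v w × Nbr H g v w′ × w ≢ w′)

  step-progress : ∀ {v a g a′ g′} → Step H v (a , g) (a′ , g′) →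
                  ((a′ , g′) ≡ (a , g) × Stuck g v) ⊎ alive-count g′ < alive-count g
  step-progress (dead ¬al)        = inj₁ (refl , λ al → contradiction al ¬al)
  step-progress (branch nw nw′ ≢) = inj₁ (refl , λ _ → _ , _ , nw , nw′ , ≢)
  step-progress {v} {g = g} {g′ = g′} (isolated {f = f} gv none g′v rest) =
    inj₂ (subst₂ _≤_ (+-comm (alive-count g′) 1) (+-identityʳ (alive-count g))
      (sum-mono₁ v (λ w w≢v → cong alive-1 (rest w≢v))
        (≤-reflexive (cong₂ (λ x y → alive-1 x + y) g′v (sym (trans (+-identityʳ _) (cong alive-1 gv)))))))
  step-progress {v} {g = g} {g′ = g′} (leaf {p = p} gv gp vp only g′v g′p rest) =
    inj₂ (subst₂ _≤_ (+-comm (alive-count g′) 1) (+-identityʳ (alive-count g))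
      (sum-mono₁ v same
        (≤-reflexive (cong₂ (λ x y → alive-1 x + y) g′v (sym (trans (+-identityʳ _) (cong alive-1 gv)))))))
    where
    same : ∀ w → w ≢ v → alive-1 (g′ w) ≡ alive-1 (g w)
    same w w≢v with w ≟ p
    ... | yes refl = trans (cong alive-1 g′p) (sym (cong alive-1 gp))
    ... | no w≢p   = cong alive-1 (rest w≢v w≢p)

  module _ (acyclic : Acyclic H) (g : Tables n) (stuck : ∀ v → Stuck g v) where

    private
      other-nbr : ∀ {x} y → Alive g x → ∃[ z ] (Nbr H g x z × z ≢ y)
      other-nbr y al with w , w′ , nw , nw′ , w≢w′ ← stuck _ al with w ≟ y
      ... | no w≢y   = w , nw , w≢y
      ... | yes refl = w′ , nw′ , ≢-sym w≢w′

      -- The path is extended at its head `x` by a neighbour `z` other than `y`, which exists as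
      -- every remaining vertex is stuck. If `z` is on the path already, the part up to `z` closes a
      -- cycle, of at least three vertices since `z` is not `y`; otherwise the path outgrows n once
      -- the fuel `k` is used up.
      grow : ∀ k x y ys → Unique (x ∷ y ∷ ys) → Linked (Adj H) (x ∷ y ∷ ys) → Alive g x →
             n < length (x ∷ y ∷ ys) + k → ⊥
      grow zero    x y ys un _  _  n< =
        <⇒≱ n< (subst (_≤ n) (sym (+-identityʳ _)) (unique-length-≤ un))
      grow (suc k) x y ys un xys al n< with z , (xz , alz) , z≢y ← other-nbr y al with Any.any? (z ≟_) ys
      ... | no z∉  = grow k z x (y ∷ ys)
                       ((≢-sym (adj-≢ H xz) ∷ z≢y ∷ ¬Any⇒All¬ ys z∉) ∷ un) (adj-sym H xz ∷ xys) alz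
                       (subst (n <_) (+-suc _ k) n<)
      ... | yes z∈ with pre , post , refl ← ∈-∃++ z∈ =
        acyclic x (y ∷ pre ++ z ∷ []) (s≤s (1≤ pre))
          (unique-++ˡ (x ∷ y ∷ pre ++ z ∷ []) (subst (λ l → Unique (x ∷ y ∷ l)) (shift pre) un))
          (linked-close (x ∷ y ∷ pre) xys (adj-sym H xz))
        where
        1≤ : ∀ pre → 1 ≤ length (pre ++ z ∷ [])
        1≤ []      = s≤s z≤n
        1≤ (_ ∷ _) = s≤s z≤n
        shift : ∀ pre → pre ++ z ∷ post ≡ (pre ++ z ∷ []) ++ post
        shift []        = refl
        shift (q ∷ pre) = cong (q ∷_) (shift pre)

    stuck⇒dead : ∀ v → ¬ Alive g v
    stuck⇒dead v al with w , _ , (vw , _) , _ ← stuck v al =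
      grow n v w [] ((adj-≢ H vw ∷ []) ∷ [] ∷ []) (vw ∷ [-]) al (m≤n⇒m≤1+n ≤-refl)

-- b-colourings and configurations

module _ {n : ℕ} (G : Graph n) where

  private
    -- Each vertex of class `i` moves to a class in which it has no neighbour. All moves can be made
    -- at once: two moved vertices come from the same class and so are not adjacent. `punchOut`
    -- closes the gap left by colour `i`.
    recolor : ∀ {t} (c : Fin n → Fin (suc t)) i → Proper G c →
              (∀ v → c v ≡ i → ∃[ j ] (j ≢ i × (∀ u → c u ≡ j → ¬ Adj G v u))) →
              ∃[ c′ ] Proper G {t} c′
    recolor {t} c i proper free = (λ v → punchOut (≢-sym (avoids v))) , λ u v a eq →
      proper′ u v a (punchOut-injective (≢-sym (avoids u)) (≢-sym (avoids v)) eq)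
      where
      c′ : Fin n → Fin (suc t)
      c′ v with c v ≟ i
      ... | yes eq = proj₁ (free v eq)
      ... | no _   = c v
      avoids : ∀ v → c′ v ≢ i
      avoids v with c v ≟ i
      ... | yes eq = proj₁ (proj₂ (free v eq))
      ... | no ≢   = ≢
      proper′ : Proper G c′
      proper′ u v a with c u ≟ i | c v ≟ i
      ... | yes p | yes q = λ _ → proper u v a (trans p (sym q))
      ... | yes p | no _  = λ eq → proj₂ (proj₂ (free u p)) v (sym eq) a
      ... | no _  | yes q = λ eq → proj₂ (proj₂ (free v q)) u eq (adj-sym G a)
      ... | no _  | no _  = proper u v a

    escape? : ∀ {t} (c : Fin n → Fin t) v → Decidable (λ j → j ≢ c v → ∃[ u ] (c u ≡ j × Adj G v u))
    escape? c v j = ¬? (j ≟ c v) →-dec any? (λ u → (c u ≟ j) ×-dec T? (adj G v u))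

    b-vertex? : ∀ {t} (c : Fin n → Fin t) i → Dec (∃[ v ] (c v ≡ i × IsBVertex G c v))
    b-vertex? c i = any? (λ v → (c v ≟ i) ×-dec all? (escape? c v))

    refine : ∀ t (c : Fin n → Fin t) → Proper G c → ∃[ s ] HasBColoring G s
    refine t c proper with all? (b-vertex? c)
    refine t       c proper | yes bv = t , c , proper , bv
    refine zero    c proper | no ¬bv = contradiction (λ ()) ¬bv
    refine (suc t) c proper | no ¬bv with i , none ← ¬∀⟶∃¬ _ _ (b-vertex? c) ¬bv =
      refine t (proj₁ fewer) (proj₂ fewer)
      where
      fewer : ∃[ c′ ] Proper G {t} c′
      fewer = recolor c i proper λ v eq →
        let j , ¬esc = ¬∀⟶∃¬ _ _ (escape? c v) (λ b → none (v , eq , b)) in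
        j , (λ j≡i → ¬esc λ j≢ → contradiction (trans j≡i (sym eq)) j≢) ,
        λ u cu a → ¬esc λ _ → u , cu , a

  has-b-coloring : ∃[ t ] HasBColoring G t
  has-b-coloring = refine n (λ v → v) (λ u v a → adj-≢ G a)

  complement⇒¬adj : ∀ {u v} → Adj (complement G) u v → ¬ Adj G u v
  complement⇒¬adj {u} {v} a b with u ≟ v | adj G u v
  ... | no _ | true = a

  ¬adj⇒complement : ∀ {u v} → u ≢ v → ¬ Adj G u v → Adj (complement G) u v
  ¬adj⇒complement {u} {v} u≢v ¬a with u ≟ v | adj G u v
  ... | yes eq | _     = u≢v eq
  ... | no _   | true  = ¬a tt
  ... | no _   | false = tt

  b-coloring-≤ : ∀ {t} → HasBColoring G t → t ≤ n
  b-coloring-≤ (c , _ , bv) = injective⇒≤ {f = λ i → proj₁ (bv i)} λ {i} {j} eq →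
    trans (sym (proj₁ (proj₂ (bv i)))) (trans (cong c eq) (proj₁ (proj₂ (bv j))))

-- `A1` and `B1` claim a mate that is already eliminated, which is impossible at the outset; n acts
-- as infinity, since a total of n or more stands for zero colours. `B0` costs 1, so a total below n
-- counts the vertices that are not chosen.
initial : ℕ → Table
initial n A0 = 0
initial n A1 = n
initial n B0 = 1
initial n B1 = n
initial n U  = 0

start : ∀ n → DPState n
start n = 0 , λ _ → just (initial n)

sum-≤ : ∀ {n} (w : Fin n → ℕ) → (∀ v → w v ≤ 1) → sum w ≤ n
sum-≤ {zero}  w w≤1 = z≤n
sum-≤ {suc n} w w≤1 = +-mono-≤ (w≤1 zero) (sum-≤ (λ v → w (suc v)) (λ v → w≤1 (suc v)))

term-≤-sum : ∀ {n} (w : Fin n → ℕ) v → w v ≤ sum w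
term-≤-sum {suc n} w v = subst (w v ≤_) (sym (sum-remove {i = v} w)) (m≤m+n (w v) _)

-- Raising the weight of one selected vertex from 0 to 1 keeps all weights at most 1; after t such
-- changes the sum is still at most n.
sum-zeros : ∀ {n t} (w : Fin n → ℕ) (r : Fin t → Fin n) → (∀ v → w v ≤ 1) →
            (∀ {i j} → r i ≡ r j → i ≡ j) → (∀ i → w (r i) ≡ 0) → sum w + t ≤ n
sum-zeros {n} {zero}  w r w≤1 inj zeros = subst (_≤ n) (sym (+-identityʳ (sum w))) (sum-≤ w w≤1)
sum-zeros {n} {suc t} w r w≤1 inj zeros = begin
  sum w + suc t    ≡⟨ +-assoc (sum w) 1 t ⟨
  sum w + 1 + t    ≤⟨ +-monoˡ-≤ t (sum-mono₁ (r zero) (λ v v≢ → sym (set-≢ (r zero) w v≢))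
                       (≤-reflexive (cong₂ _+_ (zeros zero) (sym (trans (+-identityʳ _) (set-≡ (r zero) w)))))) ⟩
  sum w′ + 0 + t   ≡⟨ cong (_+ t) (+-identityʳ (sum w′)) ⟩
  sum w′ + t       ≤⟨ sum-zeros w′ (λ i → r (suc i)) w′≤1 (λ eq → suc-injective (inj eq))
                       (λ i → trans (set-≢ (r zero) w λ eq → suc≢zero (inj eq)) (zeros (suc i))) ⟩
  n                ∎
  where
  open ≤-Reasoning
  w′ = set (r zero) 1 w
  w′≤1 : ∀ v → w′ v ≤ 1
  w′≤1 v with v ≟ r zero
  ... | yes refl = ≤-reflexive (set-≡ (r zero) w)
  ... | no v≢    = subst (_≤ 1) (sym (set-≢ (r zero) w v≢)) (w≤1 v)
  suc≢zero : ∀ {i : Fin t} → Fin.suc i ≢ zero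
  suc≢zero ()

-- Serves to find many chosen vertices in a cheap configuration: each vertex rejected by the filter
-- has to be paid for.
length-filter-≥ : ∀ {m} {A : Set} {P : A → Set} (P? : Decidable P) (f : Fin m → A) (w : Fin m → ℕ) →
                  (∀ v → ¬ P (f v) → 1 ≤ w v) → m ≤ sum w + length (filter P? (tabulate f))
length-filter-≥ {zero}  P? f w w≥1 = z≤n
length-filter-≥ {suc m} P? f w w≥1
  with P? (f zero) | length-filter-≥ P? (λ v → f (suc v)) (λ v → w (suc v)) (λ v → w≥1 (suc v))
... | yes _ | ih = subst (suc m ≤_) (sym (+-suc (sum w) _))
                     (s≤s (≤-trans ih (+-monoˡ-≤ _ (m≤n+m _ (w zero)))))
... | no ¬p | ih = subst (suc m ≤_) (sym (+-assoc (w zero) _ _)) (+-mono-≤ (w≥1 zero ¬p) ih)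

module _ {n : ℕ} (G : Graph n) (acyclic : Acyclic (complement G)) where

  private
    H = complement G
    g₀ = proj₂ (start n)

  triangle-free : ∀ {u v w} → Adj H u v → Adj H v w → ¬ Adj H w u
  triangle-free {u} {v} {w} uv vw wu = acyclic u (v ∷ w ∷ []) (s≤s (s≤s z≤n))
    ((adj-≢ H uv ∷ ≢-sym (adj-≢ H wu) ∷ []) ∷ (adj-≢ H vw ∷ []) ∷ [] ∷ []) (uv ∷ vw ∷ wu ∷ [-])

  module _ {t : ℕ} (c : Fin n → Fin t) (proper : Proper G c)
           (bv : ∀ i → ∃[ v ] (c v ≡ i × IsBVertex G c v)) where

    private
      r : Fin t → Fin n
      r i = proj₁ (bv i)

      c-r : ∀ i → c (r i) ≡ i
      c-r i = proj₁ (proj₂ (bv i))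

      same-class : ∀ {u v} → c u ≡ c v → u ≢ v → Adj H u v
      same-class eq u≢v = ¬adj⇒complement G u≢v (λ a → proper _ _ a eq)

      -- Three distinct vertices of one class would form a triangle of T.
      class-≤2 : ∀ {u v w} → c u ≡ c w → c v ≡ c w → u ≢ w → v ≢ w → u ≡ v
      class-≤2 {u} {v} {w} cu cv u≢w v≢w with u ≟ v
      ... | yes eq  = eq
      ... | no u≢v = contradiction (same-class (sym cu) (≢-sym u≢w))
        (triangle-free (same-class (trans cu (sym cv)) u≢v) (same-class cv v≢w))

      data Kind (v : Fin n) : Set where
        alone  : r (c v) ≡ v → (∀ u → c u ≡ c v → u ≡ v) → Kind v
        leader : ∀ u → r (c v) ≡ v → c u ≡ c v → u ≢ v → Kind v
        member : r (c v) ≢ v → Kind v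

      kind : ∀ v → Kind v
      kind v with r (c v) ≟ v
      ... | no rv≢ = member rv≢
      ... | yes rv with any? (λ u → (c u ≟ c v) ×-dec ¬? (u ≟ v))
      ...   | yes (u , cu , u≢v) = leader u rv cu u≢v
      ...   | no none = alone rv λ u cu → decidable-stable (u ≟ v) (λ u≢v → none (u , cu , u≢v))

      kind-state : ∀ {v} → Kind v → St
      kind-state (alone _ _)      = U
      kind-state (leader _ _ _ _) = A0
      kind-state (member _)       = B0

      kind-partner : ∀ {v} → Kind v → Fin n
      kind-partner {v} (alone _ _)      = v
      kind-partner     (leader u _ _ _) = u
      kind-partner {v} (member _)       = r (c v)

      C : Config H g₀
      C .Config.state   v = kind-state (kind v)
      C .Config.partner v = kind-partner (kind v)
      C .Config.mated {v} _ op with kind v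
      ... | leader u rv cu u≢v = (same-class (sym cu) (≢-sym u≢v) , tt) , back (kind u)
        where
        ru≢u : r (c u) ≢ u
        ru≢u eq = u≢v (trans (sym eq) (trans (cong r cu) rv))
        back : ∀ (k : Kind u) → kind-partner k ≡ v × Mate A0 (kind-state k)
        back (alone ru _)      = contradiction ru ru≢u
        back (leader _ ru _ _) = contradiction ru ru≢u
        back (member _)        = trans (cong r cu) rv , ab
      ... | member rv≢ = (same-class (sym (c-r (c v))) (≢-sym rv≢) , tt) , back (kind (r (c v)))
        where
        back : ∀ (k : Kind (r (c v))) → kind-partner k ≡ v × Mate B0 (kind-state k)
        back (alone _ only)     = contradiction (sym (only v (sym (c-r (c v))))) rv≢
        back (leader u _ cu u≢) = class-≤2 cu (sym (c-r (c v))) u≢ (≢-sym rv≢) , ba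
        back (member r≢)        = contradiction (cong r (c-r (c v))) r≢
      C .Config.lonely {u} {v} _ _ uv eq with kind u
      ... | alone _ only = isB (kind v)
        where
        cu≢cv : c u ≢ c v
        cu≢cv eq = adj-≢ H uv (sym (only v (sym eq)))
        -- If `v` were chosen, its neighbour in the class of `u` could only be `u` itself, which is
        -- not adjacent to `v` in G.
        ¬rep : r (c v) ≢ v
        ¬rep rv with x , cx , a ← proj₂ (proj₂ (bv (c v))) (c u) (subst (λ i → c u ≢ i) (sym (c-r (c v))) cu≢cv) =
          complement⇒¬adj G uv (adj-sym G (subst₂ (Adj G) rv (only x cx) a))
        isB : ∀ (k : Kind v) → IsB (kind-state k)
        isB (alone rv _)      = contradiction rv ¬rep
        isB (leader _ rv _ _) = contradiction rv ¬rep
        isB (member _)        = tt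

      r-injective : ∀ {i j} → r i ≡ r j → i ≡ j
      r-injective {i} {j} eq = trans (sym (c-r i)) (trans (cong c eq) (c-r j))

      cost-≤1 : ∀ {v} (k : Kind v) → initial n (kind-state k) ≤ 1
      cost-≤1 (alone _ _)      = z≤n
      cost-≤1 (leader _ _ _ _) = z≤n
      cost-≤1 (member _)       = s≤s z≤n

      cost-rep : ∀ {i} (k : Kind (r i)) → initial n (kind-state k) ≡ 0
      cost-rep (alone _ _)      = refl
      cost-rep (leader _ _ _ _) = refl
      cost-rep {i} (member r≢)  = contradiction (cong r (c-r i)) r≢

    b-coloring⇒config : ∃[ C ] total H {g₀} C + t ≤ n
    b-coloring⇒config = C , sum-zeros _ r (λ v → cost-≤1 (kind v)) r-injective (λ i → cost-rep (kind (r i)))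

  b-coloring⇒achieves : ∀ {t} → HasBColoring G t → Achieves H (start n) (n ∸ t)
  b-coloring⇒achieves {t} (c , proper , bv) with C , le ← b-coloring⇒config c proper bv =
    C , ≤-trans (≤-reflexive (+-identityʳ _)) (m+n≤o⇒m≤o∸n _ le)

  module _ (C : Config H g₀) (total< : total H C < n) where

    open Config C

    private
      B? : ∀ s → Dec (IsB s)
      B? A0 = no λ ()
      B? A1 = no λ ()
      B? B0 = yes tt
      B? B1 = yes tt
      B? U  = no λ ()

      -- Rules out `A1` and `B1`: a single vertex in such a state already costs n.
      possible : ∀ {v} → initial n (state v) ≢ n
      possible {v} eq = <⇒≱ total< (subst (_≤ total H C) eq (term-≤-sum _ v))

      -- Positions in this list are the colours; a vertex in a B state takes the colour of its
      -- partner.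
      reps : List (Fin n)
      reps = filter (λ v → ¬? (B? (state v))) (allFin n)

      reps-unique : Unique reps
      reps-unique = filter⁺ (λ v → ¬? (B? (state v))) (allFin⁺ n)

      B-partner : ∀ {v} → IsB (state v) → Adj H v (partner v) × partner (partner v) ≡ v × ¬ IsB (state (partner v))
      B-partner {v} b = result (state v) refl b
        where
        result : ∀ s → state v ≡ s → IsB s →
                 Adj H v (partner v) × partner (partner v) ≡ v × ¬ IsB (state (partner v))
        result B1 eq _ = contradiction (cong (initial n) eq) possible
        result B0 eq _ with (a , _) , inv , mt ← mated {v} tt (subst Open (sym eq) tt) =
          a , inv , ¬B (subst (λ s → Mate s (state (partner v))) eq mt)
          where
          ¬B : ∀ {s} → Mate B0 s → ¬ IsB s
          ¬B ba ()

      rep : Fin n → Fin n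
      rep v with B? (state v)
      ... | yes _ = partner v
      ... | no _  = v

      rep-¬B : ∀ v → ¬ IsB (state (rep v))
      rep-¬B v with B? (state v)
      ... | yes b = proj₂ (proj₂ (B-partner b))
      ... | no ¬b = ¬b

      rep-self : ∀ {v} → ¬ IsB (state v) → rep v ≡ v
      rep-self {v} ¬b with B? (state v)
      ... | yes b = contradiction b ¬b
      ... | no _  = refl

      rep-partner : ∀ {v} → IsB (state v) → rep v ≡ partner v
      rep-partner {v} b with B? (state v)
      ... | yes _ = refl
      ... | no ¬b = contradiction b ¬b

      same-rep : ∀ {u v} → rep u ≡ rep v → u ≢ v → Adj H u v
      same-rep {u} {v} eq u≢v with B? (state u) | B? (state v)
      ... | yes b | yes b′ = contradiction
        (trans (sym (proj₁ (proj₂ (B-partner b)))) (trans (cong partner eq) (proj₁ (proj₂ (B-partner b′))))) u≢v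
      ... | yes b | no _   = subst (Adj H u) eq (proj₁ (B-partner b))
      ... | no _  | yes b′ = adj-sym H (subst (Adj H v) (sym eq) (proj₁ (B-partner b′)))
      ... | no _  | no _   = contradiction eq u≢v

      rep-∈ : ∀ v → rep v ∈ reps
      rep-∈ v = ∈-filter⁺ (λ v → ¬? (B? (state v))) (∈-allFin (rep v)) (rep-¬B v)

      color : Fin n → Fin (length reps)
      color v = Any.index (rep-∈ v)

      lookup-color : ∀ v → rep v ≡ lookup reps (color v)
      lookup-color v = lookup-index (rep-∈ v)

      color-rep : ∀ {u v} → rep u ≡ rep v → color u ≡ color v
      color-rep {u} {v} eq = lookup-injective reps-unique _ _
        (trans (sym (lookup-color u)) (trans eq (lookup-color v)))

      rep-color : ∀ {u v} → color u ≡ color v → rep u ≡ rep v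
      rep-color {u} {v} eq = trans (lookup-color u) (trans (cong (lookup reps) eq) (sym (lookup-color v)))

      lookup-¬B : ∀ i → ¬ IsB (state (lookup reps i))
      lookup-¬B i = proj₂ (∈-filter⁻ (λ v → ¬? (B? (state v))) {xs = allFin n} (∈-lookup i))

      color-lookup : ∀ i → color (lookup reps i) ≡ i
      color-lookup i = lookup-injective reps-unique _ _
        (trans (sym (lookup-color (lookup reps i))) (rep-self (lookup-¬B i)))

      -- If `x` misses `y` in G, the two are adjacent in T. Then `y` is not alone in its class, as
      -- `lonely` would put `x` in a B state, so `y` has a mate; the mate is adjacent to `x` in G
      -- because T has no triangles.
      escape : ∀ {x y} → ¬ IsB (state x) → ¬ IsB (state y) → x ≢ y → ∃[ u ] (color u ≡ color y × Adj G x u)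
      escape {x} {y} ¬bx ¬by x≢y with T? (adj G x y)
      ... | yes a = y , refl , a
      ... | no ¬a = result (state y) refl ¬by
        where
        xy = ¬adj⇒complement G x≢y ¬a
        result : ∀ s → state y ≡ s → ¬ IsB s → ∃[ u ] (color u ≡ color y × Adj G x u)
        result A1 eq _  = contradiction (cong (initial n) eq) possible
        result B0 eq ¬b = contradiction tt ¬b
        result B1 eq ¬b = contradiction tt ¬b
        result U  eq _  = contradiction (lonely tt tt (adj-sym H xy) eq) ¬bx
        result A0 eq _ with (yu , _) , inv , mt ← mated {y} tt (subst Open (sym eq) tt) =
          u , color-rep (trans (rep-partner b) (trans inv (sym (rep-self ¬by)))) ,
          decidable-stable (T? (adj G x u)) (λ ¬xu →
            triangle-free xy yu (adj-sym H (¬adj⇒complement G (λ { refl → ¬bx b }) ¬xu)))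
          where
          u = partner y
          isB : ∀ {s} → Mate A0 s → IsB s
          isB ab = tt
          b : IsB (state u)
          b = isB (subst (λ s → Mate s (state u)) eq mt)

    -- An inequality suffices, as the upper bound obtained from the opposite translation turns it
    -- into an equality.
    config⇒b-coloring : ∃[ t ] (n ∸ total H C ≤ t × HasBColoring G t)
    config⇒b-coloring = length reps , m≤n+o⇒m∸n≤o n (total H C) enough , color , proper , b-vertices
      where
      enough : n ≤ total H C + length reps
      enough = length-filter-≥ (λ v → ¬? (B? (state v))) (λ v → v) _
        (λ v ¬¬b → positive (state v) (decidable-stable (B? (state v)) ¬¬b))
        where
        positive : ∀ s → IsB s → 1 ≤ initial n s
        positive B0 _ = s≤s z≤n
        positive B1 _ = ≤-trans (s≤s z≤n) total<
      proper : Proper G color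
      proper u v a eq = complement⇒¬adj G (same-rep (rep-color eq) (adj-≢ G a)) a
      b-vertices : ∀ i → ∃[ v ] (color v ≡ i × IsBVertex G color v)
      b-vertices i = lookup reps i , color-lookup i , λ j j≢ →
        let u , eq , a = escape (lookup-¬B i) (lookup-¬B j)
                           (λ eq → j≢ (trans (sym (color-lookup j)) (cong color (sym eq))))
        in u , trans eq (color-lookup j) , a

  b-chromatic-number : ∀ {a} → (∀ k → Achieves H (start n) k ⇔ a ≤ k) → IsBChromaticNumber G (n ∸ a)
  b-chromatic-number {a} opt = attained , upper
    where
    a≤ : ∀ {t} → HasBColoring G t → a ≤ n ∸ t
    a≤ b = Equivalence.to (opt _) (b-coloring⇒achieves b)
    upper : ∀ t → HasBColoring G t → t ≤ n ∸ a
    upper t b = m+n≤o⇒m≤o∸n t (subst (_≤ n) (+-comm a t) (m≤o∸n⇒m+n≤o a (b-coloring-≤ G b) (a≤ b)))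
    attained : HasBColoring G (n ∸ a)
    attained with n ≤? a | has-b-coloring G
    -- If the least cost is not below n, the upper bound admits only zero colours, so the
    -- b-colouring known to exist must be one with zero colours.
    ... | yes n≤a | t , b = subst (HasBColoring G)
      (trans (n≤0⇒n≡0 (subst (t ≤_) (m≤n⇒m∸n≡0 n≤a) (upper t b))) (sym (m≤n⇒m∸n≡0 n≤a))) b
    ... | no n≰a | _ with C , le ← Equivalence.from (opt a) ≤-refl
      with le′ ← ≤-trans (≤-reflexive (sym (+-identityʳ (total H C)))) le
      with t , n∸ , b ← config⇒b-coloring C (≤-<-trans le′ (≰⇒> n≰a)) =
      subst (HasBColoring G) (≤-antisym (upper t b) (≤-trans (∸-monoʳ-≤ n le′) n∸)) b

-- The program and its correctness

tails : ℕ → Tree → Tree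
tails zero    x = x
tails (suc k) x = tails k (tail x)

nth : ℕ → Tree → Tree
nth k x = head (tails k x)

tails-nil : ∀ k → tails k nil ≡ nil
tails-nil zero    = refl
tails-nil (suc k) = tails-nil k

reflects-map : ∀ {P Q : Set} {b} → (P → Q) → (Q → P) → Reflects P b → Reflects Q b
reflects-map f g (ofʸ p)  = ofʸ (f p)
reflects-map f g (ofⁿ ¬p) = ofⁿ λ q → ¬p (g q)

tails-reflects : ∀ k x → Reflects (k < spine x) (truth (tails k x))
tails-reflects zero    nil        = ofⁿ λ ()
tails-reflects zero    (cons _ _) = ofʸ (s≤s z≤n)
tails-reflects (suc k) nil        = subst (λ y → Reflects (suc k < 0) (truth y)) (sym (tails-nil k)) (ofⁿ λ ())
tails-reflects (suc k) (cons _ x) = reflects-map s≤s ≤-pred (tails-reflects k x)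

nth-tabulate : ∀ {n} (f : Fin n → Tree) v → nth (toℕ v) (fromList (tabulate f)) ≡ f v
nth-tabulate f zero    = refl
nth-tabulate f (suc v) = nth-tabulate (λ w → f (suc w)) v

spine-tabulate : ∀ {n} (f : Fin n → Tree) → spine (fromList (tabulate f)) ≡ n
spine-tabulate {zero}  f = refl
spine-tabulate {suc n} f = cong suc (spine-tabulate (λ w → f (suc w)))

fromBool-reflects : ∀ b → Reflects (T b) (truth (fromBool b))
fromBool-reflects true  = ofʸ tt
fromBool-reflects false = ofⁿ λ ()

choose-elim : ∀ {P : Set} {b} (Q : Tree → Set) {x y} → Reflects P b → (P → Q x) → (¬ P → Q y) → Q (choose b x y)
choose-elim Q (ofʸ p)  f g = f p
choose-elim Q (ofⁿ ¬p) f g = g ¬p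

and-reflects : ∀ {P Q : Set} {b x} → Reflects P b → Reflects Q (truth x) →
               Reflects (P × Q) (truth (choose b x nil))
and-reflects (ofʸ p)  q = reflects-map (p ,_) proj₂ q
and-reflects (ofⁿ ¬p) _ = ofⁿ λ (p , _) → ¬p p

not-and-reflects : ∀ {P Q : Set} {b x} → Reflects P b → Reflects Q (truth x) →
                   Reflects (¬ P × Q) (truth (choose b nil x))
not-and-reflects (ofⁿ ¬p) q = reflects-map (¬p ,_) proj₂ q
not-and-reflects (ofʸ p)  _ = ofⁿ λ (¬p , _) → ¬p p

or-reflects : ∀ {P Q : Set} {x y} → Reflects P (truth x) → Reflects Q (truth y) →
              Reflects (P ⊎ Q) (truth (choose (truth x) x y))
or-reflects {x = cons _ _} (ofʸ p)  _ = ofʸ (inj₁ p)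
or-reflects {x = nil}      (ofⁿ ¬p) q =
  reflects-map inj₂ (λ { (inj₁ p) → contradiction p ¬p ; (inj₂ q) → q }) q

-- The source of the program

one : Fn
one = cons nil nil

counter result : Fn
counter  = hd arg
result = hd (tl arg)

-- Inside a loop body, evaluates `f` on the argument of the enclosing loop.
outer : Fn → Fn
outer f = f ∘ tl (tl arg)

-- On `cons i x`, removes as many cells from `x` as `i` has, but at most n. It serves for indexing
-- and, as a test for a nonempty rest, for comparing numerals.
drop : Fn
drop = tl (loop arg (ite (hd result) (cons (tl (hd result)) (tl (tl result))) result))

lookupAt : Fn → Fn → Fn
lookupAt i x = hd (drop ∘ cons i x)

exists : Fn → Fn
exists f = loop nil (ite f one result)

table : Fn → Fn
table f = loop nil (cons f result)

-- One cell is put in front of the second summand for each counter value below the first, which is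
-- thereby truncated at n.
add : Fn
add = loop (tl arg) (ite (drop ∘ cons counter (outer (hd arg))) (cons nil result) result)

minimum : Fn
minimum = ite (drop ∘ cons (tl arg) (hd arg)) (tl arg) (hd arg)

-- Unrolled into straight-line code, since the lists of states are constants of the program.
leastOf : ∀ {A : Set} → (A → Fn) → List⁺ A → Fn
leastOf f (x ∷ xs) = foldr (λ y m → minimum ∘ cons (f y) m) (f x) xs

entry : St → Fn
entry A0 = hd arg
entry A1 = hd (tl arg)
entry B0 = hd (tl (tl arg))
entry B1 = hd (tl (tl (tl arg)))
entry U  = hd (tl (tl (tl (tl arg))))

entries : (St → Fn) → Fn
entries f = cons (f A0) (cons (f A1) (cons (f B0) (cons (f B1) (cons (f U) nil))))

mergeOption : St × St → Fn
mergeOption (r , s) = add ∘ cons (entry r ∘ hd arg) (entry s ∘ tl arg)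

mergeEntry : St → Fn
mergeEntry x = leastOf mergeOption (options x)

mergeTables : Fn
mergeTables = entries mergeEntry

bestEntry : Fn
bestEntry = leastOf entry closed

-- Only the spine of a numeral matters, so the input itself stands for n.
initialEntry : St → Fn
initialEntry A0 = nil
initialEntry A1 = input
initialEntry B0 = one
initialEntry B1 = input
initialEntry U  = nil

initialTable : Fn
initialTable = entries initialEntry

distinct : Fn
distinct = ite drop drop (drop ∘ cons (tl arg) (hd arg))

neighbour : Fn
neighbour = ite (distinct ∘ cons v w) (ite (lookupAt w (lookupAt v input)) nil (lookupAt w (tl (tl arg)))) nil
  where
  v = hd arg
  w = hd (tl arg)

isNeighbour hasNeighbour : Fn
isNeighbour  = neighbour ∘ cons (outer (hd arg)) (cons counter (outer (tl arg)))
hasNeighbour = exists isNeighbour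

areNeighbours hasNeighbourWith branching : Fn
areNeighbours =
  ite (neighbour ∘ cons v (cons w g)) (ite (neighbour ∘ cons v (cons counter g)) (distinct ∘ cons w counter) nil) nil
  where
  w = outer counter
  v = outer (outer (hd arg))
  g = outer (outer (tl arg))
hasNeighbourWith = exists areNeighbours
branching        = exists hasNeighbourWith

-- Reached only if `v` has at most one remaining neighbour, so at most one entry is a merge.
newEntry updated : Fn
newEntry =
  ite (neighbour ∘ cons v (cons counter g)) (mergeTables ∘ cons (lookupAt v g) (lookupAt counter g))
    (ite (distinct ∘ cons v counter) (lookupAt counter g) nil)
  where
  v = outer (hd arg)
  g = outer (tl arg)
updated = table newEntry

opaque

  step : Fn
  step = ite (lookupAt v g)
    (ite (branching ∘ cons v g) (tl arg)
      (cons (ite (hasNeighbour ∘ cons v g) a (add ∘ cons a (bestEntry ∘ lookupAt v g))) (updated ∘ cons v g)))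
    (tl arg)
    where
    v a g : Fn
    v = hd arg
    a = hd (tl arg)
    g = tl (tl arg)

  round : Fn
  round = loop arg (step ∘ cons counter result)

  rounds : Fn
  rounds = loop (cons nil (table initialTable)) (round ∘ result)

  -- Counts the loop indices that are not below the cost; this is subtraction from n.
  increment colors : Fn
  increment = ite (drop ∘ cons counter (outer arg)) result (cons nil result)
  colors    = loop nil increment

main : Fn
main = colors ∘ hd rounds

-- Meaning of the subroutines

drop-loop : ∀ z i x →
  tail (repeat (λ _ a → choose (truth (head a)) (cons (tail (head a)) (tail (tail a))) a) z (cons i x))
  ≡ tails (spine z ⊓ spine i) x
drop-loop nil        i          x = refl
drop-loop (cons _ z) nil        x = trans (drop-loop z nil x) (cong (λ m → tails m x) (⊓-zeroʳ (spine z)))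
drop-loop (cons _ z) (cons _ i) x = drop-loop z i (tail x)

-- The index of `P` is the number of iterations left, so the counter seen by the body equals the
-- index that has to be established.
repeat-invariant : ∀ {h : Tree → Tree → Tree} {n} (P : ℕ → Tree → Set) →
  (∀ (w : Fin n) i a → spine i ≡ toℕ w → P (suc (toℕ w)) a → P (toℕ w) (h i a)) →
  ∀ z → spine z ≤ n → ∀ {a} → P (spine z) a → P 0 (repeat h z a)
repeat-invariant P next nil        z≤ p = p
repeat-invariant {n = n} P next (cons _ z) z≤ {a} p =
  repeat-invariant P next z (≤-trans (n≤1+n _) z≤)
    (subst (λ k → P k _) (toℕ-fromℕ< z≤)
      (next (fromℕ< z≤) z a (sym (toℕ-fromℕ< z≤)) (subst (λ k → P (suc k) a) (sym (toℕ-fromℕ< z≤)) p)))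

module Semantics {n : ℕ} (z : Tree) (z≡n : spine z ≡ n) where

  invariant : ∀ {h : Tree → Tree → Tree} (P : ℕ → Tree → Set) →
    (∀ (w : Fin n) i a → spine i ≡ toℕ w → P (suc (toℕ w)) a → P (toℕ w) (h i a)) →
    ∀ {a} → P n a → P 0 (repeat h z a)
  invariant P next {a} p = repeat-invariant P next z (≤-reflexive z≡n) (subst (λ k → P k a) (sym z≡n) p)

  ⟦drop⟧ : ∀ i x → ⟦ drop ⟧ z (cons i x) ≡ tails (n ⊓ spine i) x
  ⟦drop⟧ i x = trans (drop-loop z i x) (cong (λ k → tails (k ⊓ spine i) x) z≡n)

  ⟦drop⟧-counter : ∀ (w : Fin n) {i} x → spine i ≡ toℕ w → ⟦ drop ⟧ z (cons i x) ≡ tails (toℕ w) x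
  ⟦drop⟧-counter w {i} x i≡ = trans (⟦drop⟧ i x)
    (cong (λ k → tails k x) (trans (cong (n ⊓_) i≡) (m≥n⇒m⊓n≡n (<⇒≤ (toℕ<n w)))))

  drop-reflects : ∀ (w : Fin n) {i} x → spine i ≡ toℕ w → Reflects (toℕ w < spine x) (truth (⟦ drop ⟧ z (cons i x)))
  drop-reflects w x i≡ = subst (λ y → Reflects (toℕ w < spine x) (truth y)) (sym (⟦drop⟧-counter w x i≡))
    (tails-reflects (toℕ w) x)

  exists-reflects : ∀ f x {Q : Fin n → Set} →
    (∀ w i a → spine i ≡ toℕ w → Reflects (Q w) (truth (⟦ f ⟧ z (cons i (cons a x))))) →
    Reflects (∃[ w ] Q w) (truth (⟦ exists f ⟧ z x))
  exists-reflects f x {Q} body = reflects-map (λ (w , _ , q) → w , q) (λ (w , q) → w , z≤n , q)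
    (invariant P next (ofⁿ λ (w , n≤w , _) → <⇒≱ (toℕ<n w) n≤w))
    where
    P : ℕ → Tree → Set
    P k a = Reflects (∃[ w ] (k ≤ toℕ w × Q w)) (truth a)
    next : ∀ (w : Fin n) i a → spine i ≡ toℕ w → P (suc (toℕ w)) a → P (toℕ w) _
    next w i a i≡ p = choose-elim (P (toℕ w)) (body w i a i≡) (λ q → ofʸ (w , ≤-refl , q)) λ ¬q →
      reflects-map (λ (u , w<u , q) → u , <⇒≤ w<u , q)
        (λ (u , w≤u , q) → u , ≤∧≢⇒< w≤u (λ eq → ¬q (subst Q (sym (toℕ-injective eq)) q)) , q) p

  -- Counters descend while cells are put in front, so the entries come out in ascending order; as
  -- long as those below k are missing, entry `u` sits at position `toℕ u ∸ k`.
  table-entries : ∀ f x (Q : Fin n → Tree → Set) →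
    (∀ w i a → spine i ≡ toℕ w → Q w (⟦ f ⟧ z (cons i (cons a x)))) →
    ∀ w → Q w (nth (toℕ w) (⟦ table f ⟧ z x))
  table-entries f x Q body w = invariant P next (λ u n≤u → contradiction n≤u (<⇒≱ (toℕ<n u))) w z≤n
    where
    P : ℕ → Tree → Set
    P k a = ∀ u → k ≤ toℕ u → Q u (nth (toℕ u ∸ k) a)
    next : ∀ (w : Fin n) i a → spine i ≡ toℕ w → P (suc (toℕ w)) a → P (toℕ w) _
    next w i a i≡ p u w≤u with u ≟ w
    ... | yes refl = subst (λ k → Q u (nth k (cons (⟦ f ⟧ z (cons i (cons a x))) a)))
                           (sym (n∸n≡0 (toℕ u))) (body u i a i≡)
    ... | no u≢w   = subst (λ k → Q u (nth k (cons (⟦ f ⟧ z (cons i (cons a x))) a)))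
                           (sym (+-∸-assoc 1 w<u)) (p u w<u)
      where w<u = ≤∧≢⇒< w≤u (λ eq → u≢w (toℕ-injective (sym eq)))

  -- Weights are numerals up to truncation at n, which all impossible states reach.
  Num : Tree → ℕ → Set
  Num x k = n ⊓ spine x ≡ n ⊓ k

  ⟦add⟧ : ∀ x y → spine (⟦ add ⟧ z (cons x y)) ≡ (n ⊓ spine x) + spine y
  ⟦add⟧ x y = invariant P next (cong (_+ spine y) (sym (n∸n≡0 (n ⊓ spine x))))
    where
    P : ℕ → Tree → Set
    -- What has been added so far is the number of counter values from k up that lie below the first
    -- summand.
    P k a = spine a ≡ ((n ⊓ spine x) ∸ (k ⊓ spine x)) + spine y
    next : ∀ (w : Fin n) i a → spine i ≡ toℕ w → P (suc (toℕ w)) a → P (toℕ w) _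
    next w i a i≡ p = choose-elim (P (toℕ w)) (drop-reflects w x i≡)
      (λ w<x → trans (cong suc p) (cong (_+ spine y) (trans
        (cong (λ m → suc ((n ⊓ spine x) ∸ m)) (m≤n⇒m⊓n≡m w<x))
        (trans (sym (+-∸-assoc 1 (⊓-glb (toℕ<n w) w<x))) (cong ((n ⊓ spine x) ∸_) (sym (m≤n⇒m⊓n≡m (<⇒≤ w<x))))))))
      (λ w≮x → trans p (cong (λ m → ((n ⊓ spine x) ∸ m) + spine y)
        (trans (m≥n⇒m⊓n≡n (m≤n⇒m≤1+n (≮⇒≥ w≮x))) (sym (m≥n⇒m⊓n≡n (≮⇒≥ w≮x))))))

  truncate-+ : ∀ a b → n ⊓ ((n ⊓ a) + b) ≡ n ⊓ (a + b)
  truncate-+ a b = begin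
    n ⊓ ((n ⊓ a) + b)        ≡⟨ cong (n ⊓_) (+-distribʳ-⊓ b n a) ⟩
    n ⊓ ((n + b) ⊓ (a + b))  ≡⟨ ⊓-assoc n (n + b) (a + b) ⟨
    (n ⊓ (n + b)) ⊓ (a + b)  ≡⟨ cong (_⊓ (a + b)) (m≤n⇒m⊓n≡m (m≤m+n n b)) ⟩
    n ⊓ (a + b)              ∎
    where open ≡-Reasoning

  add-num : ∀ {x y k l} → Num x k → Num y l → Num (⟦ add ⟧ z (cons x y)) (k + l)
  add-num {x} {y} {k} {l} xk yl = begin
    n ⊓ spine (⟦ add ⟧ z (cons x y))  ≡⟨ cong (n ⊓_) (⟦add⟧ x y) ⟩
    n ⊓ ((n ⊓ spine x) + spine y)     ≡⟨ cong (λ m → n ⊓ (m + spine y)) xk ⟩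
    n ⊓ ((n ⊓ k) + spine y)           ≡⟨ truncate-+ k (spine y) ⟩
    n ⊓ (k + spine y)                 ≡⟨ cong (n ⊓_) (+-comm k (spine y)) ⟩
    n ⊓ (spine y + k)                 ≡⟨ truncate-+ (spine y) k ⟨
    n ⊓ ((n ⊓ spine y) + k)           ≡⟨ cong (λ m → n ⊓ (m + k)) yl ⟩
    n ⊓ ((n ⊓ l) + k)                 ≡⟨ truncate-+ l k ⟩
    n ⊓ (l + k)                       ≡⟨ cong (n ⊓_) (+-comm l k) ⟩
    n ⊓ (k + l)                       ∎
    where open ≡-Reasoning

  minimum-num : ∀ {x y k l} → Num x k → Num y l → Num (⟦ minimum ⟧ z (cons x y)) (k ⊓ l)
  minimum-num {x} {y} {k} {l} xk yl = trans
    (choose-elim (λ t → n ⊓ spine t ≡ n ⊓ (spine x ⊓ spine y))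
      (subst (λ t → Reflects _ (truth t)) (sym (⟦drop⟧ y x)) (tails-reflects (n ⊓ spine y) x))
      (λ y<x → trans (sym (m≥n⇒m⊓n≡n (<⇒≤ y<x))) (swap (spine x) (spine y)))
      (λ y≮x → cong (n ⊓_) (sym (m≤n⇒m⊓n≡m (≤-trans (≮⇒≥ y≮x) (m⊓n≤n n (spine y)))))))
    (begin
      n ⊓ (spine x ⊓ spine y)  ≡⟨ ⊓-assoc n _ _ ⟨
      (n ⊓ spine x) ⊓ spine y  ≡⟨ cong (_⊓ spine y) xk ⟩
      (n ⊓ k) ⊓ spine y        ≡⟨ ⊓-assoc n k _ ⟩
      n ⊓ (k ⊓ spine y)        ≡⟨ swap k (spine y) ⟨
      k ⊓ (n ⊓ spine y)        ≡⟨ cong (k ⊓_) yl ⟩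
      k ⊓ (n ⊓ l)              ≡⟨ swap k l ⟩
      n ⊓ (k ⊓ l)              ∎)
    where
    open ≡-Reasoning
    swap : ∀ a b → a ⊓ (n ⊓ b) ≡ n ⊓ (a ⊓ b)
    swap a b = trans (sym (⊓-assoc a n b)) (trans (cong (_⊓ b) (⊓-comm a n)) (⊓-assoc n a b))

  least-num : ∀ {A : Set} (f : A → Fn) (h : A → ℕ) x → (∀ a → Num (⟦ f a ⟧ z x) (h a)) →
              ∀ as → Num (⟦ leastOf f as ⟧ z x) (least h as)
  least-num f h x num (a ∷ [])     = num a
  least-num f h x num (a ∷ b ∷ bs) = minimum-num (num b) (least-num f h x num (a ∷ bs))

  ⟦entries⟧ : ∀ f x s → ⟦ entry s ⟧ z (⟦ entries f ⟧ z x) ≡ ⟦ f s ⟧ z x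
  ⟦entries⟧ f x A0 = refl
  ⟦entries⟧ f x A1 = refl
  ⟦entries⟧ f x B0 = refl
  ⟦entries⟧ f x B1 = refl
  ⟦entries⟧ f x U  = refl

  -- The tree must be nonempty because `nil` encodes an eliminated vertex.
  IsTable : Tree → Table → Set
  IsTable x f = T (truth x) × (∀ s → Num (⟦ entry s ⟧ z x) (f s))

  merge-table : ∀ {x y f h} → IsTable x f → IsTable y h → IsTable (⟦ mergeTables ⟧ z (cons x y)) (merge f h)
  merge-table {x} {y} {f} {h} (_ , xf) (_ , yh) = tt , λ s →
    subst (λ t → Num t (merge f h s)) (sym (⟦entries⟧ mergeEntry (cons x y) s))
      (least-num mergeOption (cost-of f h) (cons x y) (λ (r , q) → add-num (xf r) (yh q)) (options s))

  best-num : ∀ {x f} → IsTable x f → Num (⟦ bestEntry ⟧ z x) (best f)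
  best-num {x} {f} (_ , xf) = least-num entry f x xf closed

  Entry : Tree → Maybe Table → Set
  Entry x nothing  = x ≡ nil
  Entry x (just f) = IsTable x f

  entry-reflects : ∀ {x} m → Entry x m → Reflects (T (is-just m)) (truth x)
  entry-reflects nothing  refl = ofⁿ λ ()
  entry-reflects {cons _ _} (just f) _ = ofʸ tt

alive⇒just : ∀ {n} {g : Tables n} {v} → Alive g v → ∃[ f ] g v ≡ just f
alive⇒just {g = g} {v} al with g v
... | just f = f , refl

-- Simulation of the elimination steps

module _ {n : ℕ} (H : Graph n) (g : Tables n) where

  -- Through `map`, neighbours that are eliminated stay so.
  merged : Fin n → Table → Tables n
  merged v f w with adj H v w | v ≟ w
  ... | true  | _     = map (merge f) (g w)
  ... | false | yes _ = nothing
  ... | false | no _  = g w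

  merged-nbr : ∀ {v f w h} → Adj H v w → g w ≡ just h → merged v f w ≡ just (merge f h)
  merged-nbr {v} {f} {w} a gw with adj H v w
  ... | true = cong (map (merge f)) gw

  merged-self : ∀ v f → merged v f v ≡ nothing
  merged-self v f with adj H v v in eq | v ≟ v
  ... | true  | _      = contradiction refl (adj-≢ H {v} {v} (subst T (sym eq) tt))
  ... | false | yes _  = refl
  ... | false | no v≢v = contradiction refl v≢v

  merged-other : ∀ {v f w} → w ≢ v → ¬ Nbr H g v w → merged v f w ≡ g w
  merged-other {v} {f} {w} w≢v ¬nw with adj H v w | v ≟ w
  ... | false | yes eq = contradiction (sym eq) w≢v
  ... | false | no _   = refl
  ... | true  | _ with g w
  ...   | nothing = refl
  ...   | just _  = contradiction (tt , tt) ¬nw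

module _ {n : ℕ} (G : Graph n) where

  private
    z = adjacencyMatrix G
    H = complement G

  open Semantics {n} z (spine-tabulate _)

  distinct-reflects : ∀ (v w : Fin n) {i j} → spine i ≡ toℕ v → spine j ≡ toℕ w →
                      Reflects (v ≢ w) (truth (⟦ distinct ⟧ z (cons i j)))
  distinct-reflects v w {i} {j} i≡ j≡ = reflects-map
    (λ { (inj₁ v<w) eq → <-irrefl (trans (cong toℕ eq) (sym j≡)) v<w
       ; (inj₂ w<v) eq → <-irrefl (trans (cong toℕ (sym eq)) (sym i≡)) w<v })
    (λ v≢w → compare v≢w)
    (or-reflects {x = ⟦ drop ⟧ z (cons i j)} (drop-reflects v j i≡) (drop-reflects w i j≡))
    where
    compare : v ≢ w → toℕ v < spine j ⊎ toℕ w < spine i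
    compare v≢w with ≤-total (toℕ v) (toℕ w)
    ... | inj₁ v≤w = inj₁ (subst (toℕ v <_) (sym j≡) (≤∧≢⇒< v≤w (λ eq → v≢w (toℕ-injective eq))))
    ... | inj₂ w≤v = inj₂ (subst (toℕ w <_) (sym i≡) (≤∧≢⇒< w≤v (λ eq → v≢w (toℕ-injective (sym eq)))))

  lookup-≡ : ∀ (w : Fin n) {i} x → spine i ≡ toℕ w → head (⟦ drop ⟧ z (cons i x)) ≡ nth (toℕ w) x
  lookup-≡ w x i≡ = cong head (⟦drop⟧-counter w x i≡)

  adjacency-≡ : ∀ (v w : Fin n) {i j} → spine i ≡ toℕ v → spine j ≡ toℕ w →
    head (⟦ drop ⟧ z (cons j (head (⟦ drop ⟧ z (cons i z))))) ≡ fromBool (adj G v w)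
  adjacency-≡ v w {i} i≡ j≡ = trans (lookup-≡ w _ j≡)
    (trans (cong (nth (toℕ w)) (trans (lookup-≡ v z i≡) (nth-tabulate _ v))) (nth-tabulate _ w))

  Entries : Tree → Tables n → Set
  Entries y g = ∀ w → Entry (nth (toℕ w) y) (g w)

  module _ {y : Tree} {g : Tables n} (ys : Entries y g) where

    lookup-entry : ∀ (w : Fin n) {i} → spine i ≡ toℕ w → Entry (head (⟦ drop ⟧ z (cons i y))) (g w)
    lookup-entry w i≡ = subst (λ t → Entry t (g w)) (sym (lookup-≡ w y i≡)) (ys w)

    alive-reflects : ∀ (w : Fin n) {i} → spine i ≡ toℕ w →
      Reflects (Alive g w) (truth (head (⟦ drop ⟧ z (cons i y))))
    alive-reflects w i≡ = entry-reflects (g w) (lookup-entry w i≡)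

    neighbour-reflects : ∀ (v w : Fin n) {i j} → spine i ≡ toℕ v → spine j ≡ toℕ w →
                         Reflects (Nbr H g v w) (truth (⟦ neighbour ⟧ z (cons i (cons j y))))
    neighbour-reflects v w {i} {j} i≡ j≡ = reflects-map
      (λ (v≢w , ¬a , al) → ¬adj⇒complement G v≢w ¬a , al)
      (λ (a , al) → adj-≢ H a , complement⇒¬adj G a , al)
      (and-reflects (distinct-reflects v w i≡ j≡)
        (not-and-reflects (subst (λ t → Reflects (Adj G v w) (truth t)) (sym (adjacency-≡ v w i≡ j≡))
                            (fromBool-reflects (adj G v w)))
                          (alive-reflects w j≡)))

    hasNeighbour-reflects : ∀ (v : Fin n) {i} → spine i ≡ toℕ v →
      Reflects (∃[ w ] Nbr H g v w) (truth (⟦ hasNeighbour ⟧ z (cons i y)))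
    hasNeighbour-reflects v {i} i≡ =
      exists-reflects isNeighbour (cons i y) λ w j a j≡ → neighbour-reflects v w i≡ j≡

    branching-reflects : ∀ (v : Fin n) {i} → spine i ≡ toℕ v →
      Reflects (∃[ w ] ∃[ w′ ] (Nbr H g v w × Nbr H g v w′ × w ≢ w′)) (truth (⟦ branching ⟧ z (cons i y)))
    branching-reflects v {i} i≡ = exists-reflects hasNeighbourWith (cons i y) λ w j a j≡ →
      exists-reflects areNeighbours (cons j (cons a (cons i y))) λ w′ j′ a′ j′≡ →
      and-reflects (neighbour-reflects v w i≡ j≡)
        (and-reflects (neighbour-reflects v w′ i≡ j′≡) (distinct-reflects w w′ j≡ j′≡))

    updated-entries : ∀ (v : Fin n) {i f} → spine i ≡ toℕ v → g v ≡ just f →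
                      Entries (⟦ updated ⟧ z (cons i y)) (merged H g v f)
    updated-entries v {i} {f} i≡ gv =
      table-entries newEntry (cons i y) (λ w t → Entry t (merged H g v f w)) λ w j a j≡ →
      choose-elim (λ t → Entry t (merged H g v f w)) (neighbour-reflects v w i≡ j≡)
        (λ (vw , al) → let h , gw = alive⇒just {g = g} al in
          subst (Entry _) (sym (merged-nbr H g vw gw))
            (merge-table (subst (Entry _) gv (lookup-entry v i≡)) (subst (Entry _) gw (lookup-entry w j≡))))
        (λ ¬nw → choose-elim (λ t → Entry t (merged H g v f w)) (distinct-reflects v w i≡ j≡)
          (λ v≢w → subst (Entry _) (sym (merged-other H g (≢-sym v≢w) ¬nw)) (lookup-entry w j≡))
          (λ ¬v≢w → subst (λ m → Entry nil m)
            (sym (subst (λ w → merged H g v f w ≡ nothing)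
                        (decidable-stable (v ≟ w) ¬v≢w) (merged-self H g v f))) refl))

  Represents : Tree → DPState n → Set
  Represents y (a , g) = Num (head y) a × Entries (tail y) g

  opaque
    unfolding step

    step-simulates : ∀ {y S} (v : Fin n) {i} → spine i ≡ toℕ v → Represents y S →
                     ∃[ S′ ] (Represents (⟦ step ⟧ z (cons i y)) S′ × Step H v S S′)
    step-simulates {y} {S@(a , g)} v {i} i≡ (ya , ys) =
      choose-elim Goal (alive-reflects ys v i≡)
        (λ al → choose-elim Goal (branching-reflects ys v i≡)
          (λ (w , w′ , nw , nw′ , w≢w′) → S , (ya , ys) , branch nw nw′ w≢w′)
          (λ ¬br → eliminate (alive⇒just {g = g} al) (λ {w} {w′} nw nw′ →
            decidable-stable (w ≟ w′) (λ w≢w′ → ¬br (w , w′ , nw , nw′ , w≢w′)))))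
        (λ ¬al → S , (ya , ys) , dead ¬al)
      where
      Goal : Tree → Set
      Goal t = ∃[ S′ ] (Represents t S′ × Step H v S S′)

      eliminate : ∃[ f ] g v ≡ just f → (∀ {w w′} → Nbr H g v w → Nbr H g v w′ → w ≡ w′) →
        Goal (cons (choose (truth (⟦ hasNeighbour ⟧ z (cons i (tail y)))) (head y)
                           (⟦ add ⟧ z (cons (head y) (⟦ bestEntry ⟧ z (head (⟦ drop ⟧ z (cons i (tail y))))))))
                   (⟦ updated ⟧ z (cons i (tail y))))
      eliminate (f , gv) unique = choose-elim (λ t → Goal (cons t (⟦ updated ⟧ z (cons i (tail y)))))
        (hasNeighbour-reflects ys v i≡)
        (λ (p , vp , al) → let h , gp = alive⇒just {g = g} al in
          (a , merged H g v f) , (ya , updated-entries ys v i≡ gv) ,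
          leaf gv gp vp (λ nw → unique nw (vp , al)) (merged-self H g v f) (merged-nbr H g vp gp)
            (λ w≢v w≢p → merged-other H g w≢v (λ nw → w≢p (unique nw (vp , al)))))
        (λ none → (a + best f , merged H g v f) ,
          (add-num ya (best-num (subst (Entry _) gv (lookup-entry ys v i≡))) , updated-entries ys v i≡ gv) ,
          isolated gv (λ nw → none (_ , nw)) (merged-self H g v f)
            (λ w≢v → merged-other H g w≢v (λ nw → none (_ , nw))))

  Equivalent : DPState n → DPState n → Set
  Equivalent S S′ = ∀ k → Achieves H S k ⇔ Achieves H S′ k

  -- A round that eliminates nothing tests all vertices in the same state.
  Progress : ℕ → DPState n → DPState n → Set
  Progress k S S′ = (S′ ≡ S × (∀ v → k ≤ toℕ v → Stuck H (proj₂ S) v)) ⊎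
                    alive-count (proj₂ S′) < alive-count (proj₂ S)

  progress-step : ∀ {S S′ S″} v → Progress (suc (toℕ v)) S S′ → Step H v S′ S″ → Progress (toℕ v) S S″
  progress-step {S} v progress st with progress | step-progress H st
  ... | inj₁ (refl , stuck) | inj₁ (refl , stuck-v) = inj₁ (refl , stuck-from)
    where
    stuck-from : ∀ w → toℕ v ≤ toℕ w → Stuck H (proj₂ S) w
    stuck-from w v≤w with v ≟ w
    ... | yes refl = stuck-v
    ... | no v≢w   = stuck w (≤∧≢⇒< v≤w (λ eq → v≢w (toℕ-injective eq)))
  ... | inj₁ (refl , _)     | inj₂ lt               = inj₂ lt
  ... | inj₂ lt             | inj₁ (refl , _)       = inj₂ lt
  ... | inj₂ lt             | inj₂ lt′              = inj₂ (<-trans lt′ lt)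

  Reached : DPState n → ℕ → Tree → Set
  Reached S k x = ∃[ S′ ] (Represents x S′ × Equivalent S S′ × Progress k S S′)

  reached-step : ∀ {S} (v : Fin n) i x → spine i ≡ toℕ v →
                 Reached S (suc (toℕ v)) x → Reached S (toℕ v) (⟦ step ⟧ z (cons i x))
  reached-step v i x i≡ (S′ , xS′ , same , progress) with S″ , xS″ , st ← step-simulates v i≡ xS′ =
    S″ , xS″ , (λ k → step-achieves H st ⇔-∘ same k) , progress-step v progress st

  opaque
    unfolding round

    round-simulates : ∀ {y S} → Represents y S → Reached S 0 (⟦ round ⟧ z y)
    round-simulates {y} {S} yS = invariant {h = λ i x → ⟦ step ⟧ z (cons i x)} (Reached S) reached-step
      (S , yS , (λ _ → ⇔-id _) , inj₁ (refl , λ v n≤v → contradiction n≤v (<⇒≱ (toℕ<n v))))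

  initial-represents : Represents (⟦ cons nil (table initialTable) ⟧ z z) (start n)
  initial-represents = refl , table-entries initialTable z (λ _ t → IsTable t (initial n)) λ _ i a _ →
    tt , λ s → trans (cong (λ t → n ⊓ spine t) (⟦entries⟧ initialEntry (cons i (cons a z)) s)) (num s)
    where
    num : ∀ s {x} → Num (⟦ initialEntry s ⟧ z x) (initial n s)
    num A0 = refl
    num A1 = cong (n ⊓_) (spine-tabulate _)
    num B0 = refl
    num B1 = cong (n ⊓_) (spine-tabulate _)
    num U  = refl

  all-dead-count : ∀ {g : Tables n} → (∀ v → ¬ Alive g v) → alive-count g ≡ 0
  all-dead-count {g} all-dead = trans (sum-cong-≗ (λ v → zero-if (g v) (all-dead v))) (sum-replicate-zero n)
    where
    zero-if : ∀ m → ¬ T (is-just m) → alive-1 m ≡ 0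
    zero-if nothing  _   = refl
    zero-if (just _) ¬al = contradiction tt ¬al

  count-all-dead : ∀ {g : Tables n} → alive-count g ≤ 0 → ∀ v → g v ≡ nothing
  count-all-dead {g} le v with g v | ≤-trans (term-≤-sum (λ v → alive-1 (g v)) v) le
  ... | nothing | _ = refl

  -- With no vertex left every configuration costs 0, so the settled cost `a` is the optimum.
  all-dead-achieves : ∀ {a} {g : Tables n} → (∀ v → g v ≡ nothing) → ∀ k → Achieves H (a , g) k ⇔ a ≤ k
  all-dead-achieves {a} {g} all-dead k = mk⇔
    (λ (C , le) → subst (λ m → m + a ≤ k) (total-0 C) le)
    (λ le → C , subst (λ m → m + a ≤ k) (sym (total-0 C)) le)
    where
    total-0 : ∀ C → total H {g} C ≡ 0
    total-0 C = trans (sum-cong-≗ (λ v → cong (λ m → weight m _) (all-dead v))) (sum-replicate-zero n)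
    ¬alive : ∀ {v} → ¬ Alive g v
    ¬alive {v} al = subst (λ m → T (is-just m)) (all-dead v) al
    C : Config H g
    C .Config.state   _ = U
    C .Config.partner v = v
    C .Config.mated  al _ = contradiction al ¬alive
    C .Config.lonely al _ _ _ = contradiction al ¬alive

  module _ (acyclic : Acyclic H) where

    opaque
      unfolding rounds

      rounds-optimal : ∃[ a ] (Num (head (⟦ rounds ⟧ z z)) a × (∀ k → Achieves H (start n) k ⇔ a ≤ k))
      rounds-optimal =
        let (a , g) , (num , _) , same , count =
              invariant {h = λ _ x → ⟦ round ⟧ z x} P next
                (start n , initial-represents , (λ _ → ⇔-id _) , sum-≤ _ (λ _ → ≤-refl))
        in a , num , λ k → all-dead-achieves (count-all-dead count) k ⇔-∘ same k
        where
        P : ℕ → Tree → Set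
        -- With k rounds to go at most k vertices remain: a round either eliminates one or finds all
        -- vertices stuck, and then none remains.
        P k x = ∃[ S ] (Represents x S × Equivalent (start n) S × alive-count (proj₂ S) ≤ k)
        next : ∀ (v : Fin n) i x → spine i ≡ toℕ v → P (suc (toℕ v)) x → P (toℕ v) (⟦ round ⟧ z x)
        next v i x _ (S , xS , same , count) with round-simulates xS
        ... | S′ , xS′ , same′ , inj₂ lt =
          S′ , xS′ , (λ k → same′ k ⇔-∘ same k) , ≤-pred (≤-trans lt count)
        ... | S′ , xS′ , same′ , inj₁ (refl , stuck) =
          S′ , xS′ , (λ k → same′ k ⇔-∘ same k) ,
          subst (_≤ toℕ v) (sym (all-dead-count (stuck⇒dead H acyclic (proj₂ S) (λ v → stuck v z≤n)))) z≤n

  opaque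
    unfolding colors

    ⟦colors⟧ : ∀ x → ⟦ colors ⟧ z x ≡ fromℕ (n ∸ spine x)
    ⟦colors⟧ x = invariant {h = λ i y → ⟦ increment ⟧ z (cons i (cons y x))} P next
      (cong fromℕ (sym (m≤n⇒m∸n≡0 (m≤m⊔n n (spine x)))))
      where
      P : ℕ → Tree → Set
      P k y = y ≡ fromℕ (n ∸ (k ⊔ spine x))
      next : ∀ (v : Fin n) i y → spine i ≡ toℕ v → P (suc (toℕ v)) y → P (toℕ v) (⟦ increment ⟧ z (cons i (cons y x)))
      next v i y i≡ p = choose-elim (P (toℕ v)) (drop-reflects v x i≡)
        (λ v<x → trans p (cong (λ m → fromℕ (n ∸ m)) (trans (m≤n⇒m⊔n≡n v<x) (sym (m≤n⇒m⊔n≡n (<⇒≤ v<x))))))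
        (λ v≮x → trans (cong (cons nil) (trans p (cong (λ m → fromℕ (n ∸ m)) (m≥n⇒m⊔n≡m (m≤n⇒m≤1+n (≮⇒≥ v≮x))))))
          (cong fromℕ (trans (sym (+-∸-assoc 1 (toℕ<n v))) (cong (n ∸_) (sym (m≥n⇒m⊔n≡m (≮⇒≥ v≮x)))))))

  main-correct : Acyclic H → ∃[ χ ] (IsBChromaticNumber G χ × ⟦ main ⟧ z z ≡ fromℕ χ)
  main-correct acyclic with a , num , opt ← rounds-optimal acyclic =
    n ∸ a , b-chromatic-number G acyclic opt ,
    trans (⟦colors⟧ (head (⟦ rounds ⟧ z z))) (cong fromℕ (∸-cong num))
    where
    -- This makes truncated weights harmless: subtraction from n sees only the part of a number up
    -- to n.
    ∸-cong : ∀ {k l} → n ⊓ k ≡ n ⊓ l → n ∸ k ≡ n ∸ l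
    ∸-cong {k} {l} eq = trans (∸-⊓ k) (trans (cong (n ∸_) eq) (sym (∸-⊓ l)))
      where
      ∸-⊓ : ∀ k → n ∸ k ≡ n ∸ (n ⊓ k)
      ∸-⊓ k = sym (trans (∸-distribˡ-⊓-⊔ n n k) (cong (_⊔ (n ∸ k)) (n∸n≡0 n)))

polytime-b-chromatic-number : ∀ f →
  (∀ n (G : Graph n) → IsCotree G →
    ∃[ χ ] (IsBChromaticNumber G χ × ⟦ f ⟧ (adjacencyMatrix G) (adjacencyMatrix G) ≡ fromℕ χ)) →
  ∃[ p ] ∃[ c ] ∃[ d ] (∀ (n : ℕ) (G : Graph n) → IsCotree G →
    ∃[ χ ] ∃[ t ] ( IsBChromaticNumber G χ
                  × Runs p (adjacencyMatrix G) (fromℕ χ) t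
                  × t ≤ c * size (adjacencyMatrix G) ^ d + c ))
polytime-b-chromatic-number f correct with c , d , polytime ← program-polytime f =
  program f , c , d , λ n G cotree →
  let χ , χ-correct , output = correct n G cotree
      t , run , t≤ = polytime (adjacencyMatrix G)
  in χ , t , χ-correct , subst (λ y → Runs (program f) (adjacencyMatrix G) y t) output run , t≤

theorem9 : ∃[ p ] ∃[ c ] ∃[ d ] (∀ (n : ℕ) (G : Graph n) → IsCotree G →
    ∃[ χ ] ∃[ t ] ( IsBChromaticNumber G χ
    × Runs p (adjacencyMatrix G) (fromℕ χ) t
    × t ≤ c * size (adjacencyMatrix G) ^ d + c ))
theorem9 = polytime-b-chromatic-number main λ n G (_ , acyclic) → main-correct G acyclic
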